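{- For any weighted digraph $\Gamma$ with Kirchhoff matrix $L$ and out forest dimension $v$, and any $\tau>0$, $$Q(\tau)=(I+\tau L)^{ -1}=s^{ -1}(\tau)\sum_{i=0}^{n-v}s_{n-v-i}(\tau)\,(-\tau L)^i,$$ where $s_k(\tau)=\sum_{j=0}^{k}\tau^j\sigma_j$, $k=0,\dots,n-v$, and $s^{ -1}(\tau)=1/s(\tau)$ with $s(\tau)=\sum_{j=0}^{n-v}\tau^j\sigma_j$.
   Context: $\Gamma$ is a weighted digraph without loops with vertex set $\{1,\dots,n\}$, $n>1$; all arcs have strictly positive real weights; $\varepsilon_{ij}$ denotes the weight of the arc from $i$ to $j$, with $\varepsilon_{ij}=0$ if and only if there is no such arc. The Kirchhoff matrix $L=(\ell_{ij})$ is the $n\times n$ matrix with $\ell_{ij}=-\varepsilon_{ji}$ for $j\ne i$ and $\ell_{ii}=-\sum_{k\ne i}\ell_{ik}$. For $\tau>0$, $Q(\tau)=(I+\tau L)^{ -1}$ (the inverse exists). A diverging forest is a digraph without (directed) circuits in which every vertex has indegree at most 1. An out forest of $\Gamma$ is a spanning subgraph of $\Gamma$ that is a diverging forest. The weight of a subgraph is the product of the weights of its arcs (1 if it has no arcs); the weight of a set of subgraphs is the sum of the weights of its elements (0 for the empty set). The out forest dimension $v$ is the minimum number of weak components of an out forest of $\Gamma$, so the maximum number of arcs of an out forest is $n-v$. $\sigma_k$ is the total weight of the set of all out forests of $\Gamma$ with $k$ arcs. -}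

module Defs where

open import Level using (Level; _⊔_; suc)
open import Data.Bool.Base using (if_then_else_)
open import Data.Nat.Base as ℕ using (ℕ; zero)
import Data.Nat.Properties as ℕ
open import Data.Fin.Base using (Fin; toℕ)
open import Data.Fin.Properties using (_≟_; all?)
open import Data.Fin.Subset using (Subset; inside; outside; _∈_; _⊆_)
open import Data.Fin.Subset.Properties using (_∈?_; _⊆?_)
open import Data.Vec.Base using (Vec; []; _∷_; lookup)
open import Data.Vec.Properties using (∷-injective)
open import Data.List.Base as List
  using (List; []; _∷_; [_]; length; map; filter; foldr; allFin; cartesianProduct; cartesianProductWith)
open import Data.List.Membership.Propositional using () renaming (_∈_ to _∈ₗ_)
open import Data.List.Membership.Propositional.Properties
  using (∈-allFin; ∈-cartesianProductWith⁺)
open import Data.List.Relation.Unary.All as All using ()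
open import Data.List.Relation.Unary.AllPairs as AllPairs using ()
open import Data.List.Relation.Unary.Unique.Propositional using (Unique)
import Data.List.Relation.Unary.Unique.Propositional.Properties as Unique
open import Data.List.Relation.Unary.Any using (here; there)
open import Data.Product.Base using (_×_; _,_; ∃-syntax; proj₁; proj₂)
open import Data.Sum.Base using (_⊎_; inj₁; inj₂)
open import Function.Bundles using (_⇔_; Bijection)
open import Relation.Binary.Core using (Rel)
open import Relation.Binary.Bundles using (Setoid)
open import Relation.Binary.Definitions using (Decidable)
open import Relation.Binary.Structures using (IsStrictPartialOrder)
open import Relation.Binary.PropositionalEquality as ≡ using (_≡_)
open import Relation.Binary.Construct.Closure.Transitive as Plus using (TransClosure)
import Relation.Binary.Construct.Closure.Equivalence as Equivalence
open import Relation.Nullary.Negation using (¬_)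
open import Relation.Nullary.Decidable using (Dec; does; map′; ¬?; _×-dec_; _⊎-dec_)
open import Algebra.Bundles using (CommutativeRing)
open import Algebra.Apartness.Bundles using (HeytingField)
import Algebra.Properties.Monoid.Sum as MonoidSum
import Algebra.Properties.Semiring.Exp as Exp
import Algebra.Properties.AbelianGroup as AbelianGroupProperties

------------------------------------------------------------------------
-- The transitive closure of a decidable relation on Fin n is decidable
-- (Floyd–Warshall).

module _ {ℓ} {n : ℕ} {R : Rel (Fin n) ℓ} where

  -- Nonempty walks whose inner vertices all lie in the given list.
  Via : List (Fin n) → Rel (Fin n) ℓ
  Via []       i j = R i j
  Via (k ∷ ks) i j = Via ks i j ⊎ (Via ks i k × Via ks k j)

  via? : Decidable R → ∀ ks → Decidable (Via ks)
  via? R? []       i j = R? i j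
  via? R? (k ∷ ks) i j = via? R? ks i j ⊎-dec (via? R? ks i k ×-dec via? R? ks k j)

  via⇒plus : ∀ ks {i j} → Via ks i j → TransClosure R i j
  via⇒plus []       r              = Plus.[ r ]
  via⇒plus (k ∷ ks) (inj₁ p)       = via⇒plus ks p
  via⇒plus (k ∷ ks) (inj₂ (p , q)) = via⇒plus ks p Plus.++ via⇒plus ks q

  step⇒via : ∀ ks {i j} → R i j → Via ks i j
  step⇒via []       r = r
  step⇒via (k ∷ ks) r = inj₁ (step⇒via ks r)

  via-join : ∀ ks {i m j} → m ∈ₗ ks → Via ks i m → Via ks m j → Via ks i j
  via-join (k ∷ ks) (here ≡.refl) p q = inj₂ (into p , outof q)
    where
    into : ∀ {i} → Via (k ∷ ks) i k → Via ks i k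
    into (inj₁ p)       = p
    into (inj₂ (p , _)) = p
    outof : ∀ {j} → Via (k ∷ ks) k j → Via ks k j
    outof (inj₁ q)       = q
    outof (inj₂ (_ , q)) = q
  via-join (k ∷ ks) (there m∈) (inj₁ p)        (inj₁ q)        = inj₁ (via-join ks m∈ p q)
  via-join (k ∷ ks) (there m∈) (inj₁ p)        (inj₂ (q , q′)) = inj₂ (via-join ks m∈ p q , q′)
  via-join (k ∷ ks) (there m∈) (inj₂ (p , p′)) (inj₁ q)        = inj₂ (p , via-join ks m∈ p′ q)
  via-join (k ∷ ks) (there m∈) (inj₂ (p , _))  (inj₂ (_ , q′)) = inj₂ (p , q′)

  plus⇒via : ∀ {i j} → TransClosure R i j → Via (allFin n) i j
  plus⇒via Plus.[ r ]             = step⇒via (allFin n) r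
  plus⇒via (Plus._∷_ {y = y} r p) =
    via-join (allFin n) (∈-allFin y) (step⇒via (allFin n) r) (plus⇒via p)

  transClosure? : Decidable R → Decidable (TransClosure R)
  transClosure? R? i j = map′ (via⇒plus (allFin n)) plus⇒via (via? R? (allFin n) i j)

------------------------------------------------------------------------
-- Digraphs on the vertex set Fin n

-- Row i of the adjacency matrix is the set of heads of the arcs leaving i.
Digraph : ℕ → Set
Digraph n = Vec (Subset n) n

Arc : ∀ {n} → Digraph n → Rel (Fin n) _
Arc G i j = j ∈ lookup G i

arc? : ∀ {n} (G : Digraph n) → Decidable (Arc G)
arc? G i j = j ∈? lookup G i

arcs : ∀ {n} → Digraph n → List (Fin n × Fin n)
arcs {n} G = filter (λ (i , j) → arc? G i j) (cartesianProduct (allFin n) (allFin n))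

numArcs : ∀ {n} → Digraph n → ℕ
numArcs G = length (arcs G)

indegree : ∀ {n} → Digraph n → Fin n → ℕ
indegree {n} G j = length (filter (λ i → arc? G i j) (allFin n))

-- The nonempty closed directed walks through i; a digraph has a circuit
-- exactly when it has one of these.
Circuit : ∀ {n} → Digraph n → Fin n → Set
Circuit G i = TransClosure (Arc G) i i

record IsDivergingForest {n} (F : Digraph n) : Set where
  constructor _,_
  field
    acyclic    : ∀ i → ¬ Circuit F i
    indegree≤1 : ∀ j → indegree F j ℕ.≤ 1

isDivergingForest? : ∀ {n} (F : Digraph n) → Dec (IsDivergingForest F)
isDivergingForest? F =
  map′ (λ (a , b) → a , b) (λ (a , b) → a , b)
    (all? (λ i → ¬? (transClosure? (arc? F) i i)) ×-dec
     all? (λ j → indegree F j ℕ.≤? 1))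

SpanningSubgraph : ∀ {n} → Digraph n → Digraph n → Set
SpanningSubgraph H G = ∀ i → lookup H i ⊆ lookup G i

IsOutForest : ∀ {n} → Digraph n → Digraph n → Set
IsOutForest G F = SpanningSubgraph F G × IsDivergingForest F

isOutForest? : ∀ {n} (G F : Digraph n) → Dec (IsOutForest G F)
isOutForest? G F =
  all? (λ i → lookup F i ⊆? lookup G i) ×-dec isDivergingForest? F

-- Vertices up to weak connectedness, i.e. joined by a walk that may
-- traverse arcs in either direction.
weakComponents : ∀ {n} → Digraph n → Setoid _ _
weakComponents G = Equivalence.setoid (Arc G)

HasWeakComponents : ∀ {n} → Digraph n → ℕ → Set
HasWeakComponents G k = Bijection (weakComponents G) (≡.setoid (Fin k))

record IsOutForestDimension {n} (G : Digraph n) (v : ℕ) : Set where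
  field
    attained : ∃[ F ] IsOutForest G F × HasWeakComponents F v
    minimal  : ∀ F k → IsOutForest G F → HasWeakComponents F k → v ℕ.≤ k

vectors : ∀ {a} {A : Set a} → List A → ∀ n → List (Vec A n)
vectors xs zero      = [ [] ]
vectors xs (ℕ.suc n) = cartesianProductWith _∷_ xs (vectors xs n)

∈-vectors : ∀ {a} {A : Set a} {xs : List A} → (∀ x → x ∈ₗ xs) →
            ∀ {n} (v : Vec A n) → v ∈ₗ vectors xs n
∈-vectors x∈xs []      = here ≡.refl
∈-vectors x∈xs (x ∷ v) = ∈-cartesianProductWith⁺ _∷_ (x∈xs x) (∈-vectors x∈xs v)

vectors-unique : ∀ {a} {A : Set a} {xs : List A} → Unique xs →
                 ∀ n → Unique (vectors xs n)
vectors-unique xs! zero      = All.[] AllPairs.∷ AllPairs.[]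
vectors-unique xs! (ℕ.suc n) =
  Unique.cartesianProductWith⁺ _∷_ ∷-injective xs! (vectors-unique xs! n)

-- Every digraph on Fin n, exactly once.
digraphs : ∀ n → List (Digraph n)
digraphs n = vectors (vectors (outside ∷ inside ∷ []) n) n

∈-digraphs : ∀ {n} (G : Digraph n) → G ∈ₗ digraphs n
∈-digraphs = ∈-vectors (∈-vectors λ where
  outside → here ≡.refl
  inside  → there (here ≡.refl))

digraphs-unique : ∀ n → Unique (digraphs n)
digraphs-unique n = vectors-unique (vectors-unique sides! n) n
  where
  sides! : Unique (outside ∷ inside ∷ [])
  sides! = ((λ ()) All.∷ All.[]) AllPairs.∷ (All.[] AllPairs.∷ AllPairs.[])

outForests : ∀ {n} → Digraph n → ℕ → List (Digraph n)
outForests {n} G k =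
  filter (λ F → isOutForest? G F ×-dec numArcs F ℕ.≟ k) (digraphs n)

------------------------------------------------------------------------
-- Ordered fields

-- The field of real numbers enters only through these axioms.  They are
-- the constructive form (apartness in place of decidable equality);
-- classically they describe exactly the linearly ordered fields.
record OrderedField c ℓ₁ ℓ₂ ℓ₃ : Set (suc (c ⊔ ℓ₁ ⊔ ℓ₂ ⊔ ℓ₃)) where
  infix 4 _<_
  field
    heytingField         : HeytingField c ℓ₁ ℓ₂
  open HeytingField heytingField public hiding (apartnessRelation)
  field
    _<_                  : Rel Carrier ℓ₃
    isStrictPartialOrder : IsStrictPartialOrder _≈_ _<_
    #⇔<⊎>                : ∀ {x y} → x # y ⇔ (x < y ⊎ y < x)
    +-monoˡ-<            : ∀ z {x y} → x < y → x + z < y + z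
    *-pos                : ∀ {x y} → 0# < x → 0# < y → 0# < x * y

  commutativeRing : CommutativeRing c ℓ₁
  commutativeRing = record { isCommutativeRing = isCommutativeRing }

  open CommutativeRing commutativeRing public
    using (semiring; +-monoid; +-abelianGroup)

  x-0≈x : ∀ x → x - 0# ≈ x
  x-0≈x x = trans (+-congˡ (AbelianGroupProperties.ε⁻¹≈ε +-abelianGroup)) (+-identityʳ x)

  1/ : ∀ {x} → x # 0# → Carrier
  1/ x#0 = proj₁ (#⇒invertible x#0)

  1/-inverseˡ : ∀ {x} (x#0 : x # 0#) → 1/ x#0 * x ≈ 1#
  1/-inverseˡ {x} x#0 =
    trans (*-congˡ (sym (x-0≈x x))) (proj₁ (proj₂ (#⇒invertible x#0)))

------------------------------------------------------------------------
-- Matrices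

module Matrices {c ℓ₁ ℓ₂ ℓ₃} (K : OrderedField c ℓ₁ ℓ₂ ℓ₃) where

  open OrderedField K
  open MonoidSum +-monoid using (sum)

  Matrix : ℕ → Set c
  Matrix n = Fin n → Fin n → Carrier

  infix  4 _≈ᴹ_
  infixl 6 _+ᴹ_
  infixl 7 _*ᴹ_
  infixr 7 _·_
  infixr 8 _^ᴹ_

  _≈ᴹ_ : ∀ {n} → Rel (Matrix n) ℓ₁
  A ≈ᴹ B = ∀ i j → A i j ≈ B i j

  I : ∀ {n} → Matrix n
  I i j = if does (i ≟ j) then 1# else 0#

  _+ᴹ_ : ∀ {n} → Matrix n → Matrix n → Matrix n
  (A +ᴹ B) i j = A i j + B i j

  _*ᴹ_ : ∀ {n} → Matrix n → Matrix n → Matrix n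
  (A *ᴹ B) i j = sum (λ k → A i k * B k j)

  _·_ : ∀ {n} → Carrier → Matrix n → Matrix n
  (a · A) i j = a * A i j

  _^ᴹ_ : ∀ {n} → Matrix n → ℕ → Matrix n
  A ^ᴹ zero    = I
  A ^ᴹ ℕ.suc m = A *ᴹ A ^ᴹ m

  sumᴹ : ∀ {n m} → (Fin m → Matrix n) → Matrix n
  sumᴹ A i j = sum (λ k → A k i j)

  IsInverse : ∀ {n} → Matrix n → Matrix n → Set ℓ₁
  IsInverse A B = (A *ᴹ B ≈ᴹ I) × (B *ᴹ A ≈ᴹ I)

------------------------------------------------------------------------
-- Weighted digraphs

module WeightedDigraphs {c ℓ₁ ℓ₂ ℓ₃} (K : OrderedField c ℓ₁ ℓ₂ ℓ₃) where

  open OrderedField K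
  open Matrices K
  open MonoidSum +-monoid using (sum)
  open Exp semiring using (_^_)

  record WeightedDigraph (n : ℕ) : Set (c ⊔ ℓ₁ ⊔ ℓ₃) where
    field
      digraph      : Digraph n
      loopless     : ∀ i → ¬ Arc digraph i i
      ε            : Fin n → Fin n → Carrier
      arc⇒positive : ∀ {i j} → Arc digraph i j → 0# < ε i j
      ¬arc⇒zero    : ∀ {i j} → ¬ Arc digraph i j → ε i j ≈ 0#

  module _ {n : ℕ} (Γ : WeightedDigraph n) where
    open WeightedDigraph Γ

    -- ℓᵢⱼ = - εⱼᵢ for j ≠ i (note the transposition).  The diagonal entry
    -- is the negated sum of the off-diagonal entries of its row.
    L-off : Matrix n
    L-off i j = if does (i ≟ j) then 0# else - ε j i

    L : Matrix n
    L i j = if does (i ≟ j) then - sum (λ k → L-off i k) else - ε j i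

    weight : Digraph n → Carrier
    weight H = foldr _*_ 1# (map (λ (i , j) → ε i j) (arcs H))

    σ : ℕ → Carrier
    σ k = foldr _+_ 0# (map weight (outForests digraph k))

    s : ℕ → Carrier → Carrier
    s k τ = sum {ℕ.suc k} (λ j → τ ^ toℕ j * σ (toℕ j))

{-# OPTIONS --safe #-}

-- The recurrence  Q₀ = σ₀ I,  Qₖ₊₁ + L Qₖ = σₖ₊₁ I  holds for the matrices Qₖ
-- whose (i , j) entry is the total weight of the out forests with k arcs in
-- which i lies in the tree with root j.  Row i of it only concerns the choice
-- of the parent of i: for a fixed forest g in which i is a root, summing both
-- sides over all ways of giving i a parent turns it into a polynomial
-- identity.  Since Qₖ = 0 for k = n - v + 1, the partial sums
-- S = Σᵢ s_{m-i}(τ) (-τL)ⁱ  with m = n - v, which satisfy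
-- Sₖ₊₁ = sₖ₊₁ I - τ L Sₖ = Sₖ + τᵏ⁺¹ Qₖ₊₁, become stationary, whence
-- (I + τL) S = s I.

module Submission where

open import Defs
open import Algebra.Bundles using (CommutativeMonoid; CommutativeRing; CommutativeSemiring)
import Algebra.Properties.CommutativeMonoid.Sum as CommutativeMonoidSum
import Algebra.Properties.Group as GroupProperties
import Algebra.Properties.Monoid.Sum as MonoidSum
import Algebra.Properties.Ring as RingProperties
import Algebra.Properties.Semiring.Exp as Exp
import Algebra.Properties.Semiring.Sum as SemiringSum
import Algebra.Solver.Ring.NaturalCoefficients.Default as SemiringSolver
open import Data.Bool.Base using (true; false; if_then_else_)
open import Data.Fin.Base as Fin using (Fin; punchIn; toℕ)
open import Data.Fin.Induction using (spo-wellFounded)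
open import Data.Fin.Properties as Fin using (_≟_; all?; punchInᵢ≢i)
open import Data.List.Base as List
  using (List; []; _∷_; _++_; length; map; filter; foldr; head; allFin; cartesianProduct; cartesianProductWith)
open import Data.List.Membership.Propositional using () renaming (_∈_ to _∈ₗ_)
open import Data.List.Membership.Propositional.Properties
  using (∈-allFin; ∈-map⁺; ∈-map⁻; ∈-filter⁺; ∈-filter⁻; ∈-lookup)
open import Data.List.Membership.Propositional.Properties.WithK using (unique∧set⇒bag; unique⇒irrelevant)
import Data.List.Membership.Setoid.Properties as ∈-Setoid
import Data.List.Properties as List
open import Data.List.Relation.Binary.BagAndSetEquality using (∼bag⇒↭)
open import Data.List.Relation.Binary.Permutation.Propositional using (_↭_; prep; swap)
open import Data.List.Relation.Unary.All as All using (_∷_)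
open import Data.List.Relation.Unary.AllPairs using (_∷_)
open import Data.List.Relation.Unary.Any as Any using (here; there)
open import Data.List.Relation.Unary.Unique.Propositional using (Unique)
import Data.List.Relation.Unary.Unique.Propositional.Properties as Unique
open import Data.Maybe.Base using (Maybe; just; nothing; maybe)
open import Data.Maybe.Properties using (just-injective; ≡-dec)
open import Data.Nat.Base as ℕ using (ℕ; zero; suc; _>_; _∸_; z≤n; s≤s)
import Data.Nat.Properties as ℕ
open import Data.Product.Base using (_×_; _,_; proj₁; proj₂; Σ-syntax; ∃-syntax)
open import Data.Sum.Base using (_⊎_; inj₁; inj₂)
open import Data.Vec.Base using (Vec; []; _∷_; lookup; replicate; tabulate; _[_]≔_)
open import Data.Vec.Properties
  using ( lookup∘update; lookup∘update′; lookup∘tabulate; lookup-replicate; lookup⇒[]=; []=⇒lookup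
        ; tabulate∘lookup; tabulate-cong)
open import Function.Base using (_∘_; const)
open import Function.Bundles using (Equivalence; mk⇔)
open import Induction.WellFounded using (Acc; acc)
open import Relation.Binary.Construct.Closure.Equivalence as Equivalence using (EqClosure)
open import Relation.Binary.Construct.Closure.Transitive as Plus using (TransClosure; [_]; _∷_)
open import Relation.Binary.PropositionalEquality as ≡ using (_≡_; _≢_; cong; cong₂; subst)
open import Relation.Binary.Structures using (IsStrictPartialOrder)
open import Relation.Nullary.Decidable
  using (Dec; yes; no; does; map′; ¬?; _×-dec_; dec-true; dec-false; does-⇔)
open import Relation.Nullary.Negation using (¬_; contradiction)
open import Relation.Unary using (Pred; Decidable)

-- Sums over out forests are transported to sums over parent functions, because there the entries
-- are chosen independently and the weight is a product over vertices. As `ε` vanishes off the arcs,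
-- the weight itself enforces being a subgraph, so the combinatorics can treat all pairs of vertices
-- alike. Row `i` of `L` involves only weights of arcs into `i`. Giving `i` the parent `r` yields a
-- forest exactly when `r` does not descend from `i`, and it then moves the tree of `i` to the root
-- of `r`; hence everything in a fibre is determined by the roots in `g`. Terms with two weights
-- `ε p i` and `ε r i` are matched by exchanging `p` and `r` where needed. The bound on the number
-- of arcs needs a translation, since `v` counts weak components: a forest has one root per
-- component, and every other vertex is the head of exactly one arc. Positivity of the weights makes
-- `s` apart from zero, the arcless forest contributing 1.

-- Forests as parent functions

-- A forest is encoded by its parent function; the vertices sent to nothing
-- are the roots.
Parents : ℕ → Set
Parents n = Vec (Maybe (Fin n)) n

module _ {n} (f : Parents n) where

  data Root : Fin n → Fin n → Set where
    stop : ∀ {p} → lookup f p ≡ nothing → Root p p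
    step : ∀ {p q r} → lookup f p ≡ just q → Root q r → Root p r

  -- Every chain of parents ends in a root. This is acyclicity in a form that carries the root of
  -- each vertex as data.
  Forest : Set
  Forest = ∀ p → ∃[ r ] Root p r

  toDigraph : Digraph n
  toDigraph = tabulate λ i → tabulate λ j → does (≡-dec _≟_ (lookup f j) (just i))

module _ {n} {f : Parents n} where

  nothing≢just : ∀ {p q} → lookup f p ≡ nothing → lookup f p ≢ just q
  nothing≢just e e′ with () ← ≡.trans (≡.sym e) e′

  root-unique : ∀ {p r r′} → Root f p r → Root f p r′ → r ≡ r′
  root-unique (stop _)   (stop _)    = ≡.refl
  root-unique (stop e)   (step e′ _) = contradiction e′ (nothing≢just e)
  root-unique (step e _) (stop e′)   = contradiction e (nothing≢just e′)
  root-unique (step e ρ) (step e′ ρ′) with ≡.refl ← just-injective (≡.trans (≡.sym e) e′) =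
    root-unique ρ ρ′

  root-orphan : ∀ {p r} → Root f p r → lookup f r ≡ nothing
  root-orphan (stop e)   = e
  root-orphan (step _ ρ) = root-orphan ρ

  lookup-toDigraph : ∀ i j →
    lookup (lookup (toDigraph f) i) j ≡ does (≡-dec _≟_ (lookup f j) (just i))
  lookup-toDigraph i j =
    ≡.trans (cong (λ row → lookup row j) (lookup∘tabulate _ i)) (lookup∘tabulate _ j)

  arc⇒parent : ∀ {i j} → Arc (toDigraph f) i j → lookup f j ≡ just i
  arc⇒parent {i} {j} a
    with ≡-dec _≟_ (lookup f j) (just i) | ≡.trans (≡.sym (lookup-toDigraph i j)) ([]=⇒lookup a)
  ... | yes e | _ = e

  parent⇒arc : ∀ {i j} → lookup f j ≡ just i → Arc (toDigraph f) i j
  parent⇒arc {i} {j} e =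
    lookup⇒[]= j _ (≡.trans (lookup-toDigraph i j) (dec-true (≡-dec _≟_ (lookup f j) (just i)) e))

  -- The last arc of a circuit through `p` comes from the parent of `p`, so the circuit can be
  -- rotated to one through that parent. Climbing the chain of parents leads to a circuit through a
  -- root, which no arc enters.
  forest⇒acyclic : Forest f → ∀ i → ¬ Circuit (toDigraph f) i
  forest⇒acyclic F i = go (proj₂ (F i))
    where
    -- The walk without its last arc may be empty; it is therefore returned as a function that
    -- prepends an arc to it.
    unsnoc : ∀ {p q} → TransClosure (Arc (toDigraph f)) p q →
             ∃[ m ] lookup f q ≡ just m × (∀ {x} → Arc (toDigraph f) x p → TransClosure (Arc (toDigraph f)) x m)
    unsnoc [ a ]   = _ , arc⇒parent a , [_]
    unsnoc (a ∷ w) with m , e , k ← unsnoc w = m , e , λ b → b ∷ k a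

    go : ∀ {p r} → Root f p r → ¬ Circuit (toDigraph f) p
    go (stop e)   w with m , e′ , _ ← unsnoc w = nothing≢just e e′
    go (step e ρ) w with m , e′ , k ← unsnoc w
      with ≡.refl ← just-injective (≡.trans (≡.sym e) e′) = go ρ (k (parent⇒arc e))

  -- Acyclicity makes the transitive closure of the arcs a strict partial order. On a finite set it
  -- is well-founded, so climbing from child to parent terminates.
  acyclic⇒forest : (∀ i → ¬ Circuit (toDigraph f) i) → Forest f
  acyclic⇒forest acyclic p = go p (spo-wellFounded spo p)
    where
    spo : IsStrictPartialOrder _≡_ (TransClosure (Arc (toDigraph f)))
    spo = record
      { isEquivalence = ≡.isEquivalence
      ; irrefl        = λ where ≡.refl → acyclic _
      ; trans         = Plus._++_
      ; <-resp-≈      = ≡.resp₂ _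
      }

    go : ∀ p → Acc (TransClosure (Arc (toDigraph f))) p → ∃[ r ] Root f p r
    go p (acc rs) with lookup f p in e
    ... | nothing = p , stop e
    ... | just q  with r , ρ ← go q (rs [ parent⇒arc e ]) = r , step e ρ

forest? : ∀ {n} (f : Parents n) → Dec (Forest f)
forest? f = map′ acyclic⇒forest forest⇒acyclic
  (all? λ i → ¬? (transClosure? (arc? (toDigraph f)) i i))

RootedForest : ∀ {n} → Parents n → Fin n → Fin n → Set
RootedForest f p r = Forest f × Root f p r

rootedForest? : ∀ {n} (f : Parents n) p r → Dec (RootedForest f p r)
rootedForest? f p r with forest? f
... | no ¬F = no (¬F ∘ proj₁)
... | yes F = map′ (λ where ≡.refl → F , proj₂ (F p)) (λ (_ , ρ) → root-unique (proj₂ (F p)) ρ)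
                   (proj₁ (F p) ≟ r)

-- Giving a parent to a root

module _ {n} (g : Parents n) (i : Fin n) (orphan : lookup g i ≡ nothing) (q : Fin n) where

  private
    g′ : Parents n
    g′ = g [ i ]≔ just q

    new : lookup g′ i ≡ just q
    new = lookup∘update i g (just q)

    old : ∀ {p} → p ≢ i → lookup g′ p ≡ lookup g p
    old p≢i = lookup∘update′ p≢i g (just q)

  -- The chain from `p` avoids `i`: having no parent in `g`, `i` could only be its last vertex, and
  -- that is `r`.
  root-kept : ∀ {p r} → r ≢ i → Root g p r → Root g′ p r
  root-kept r≢i (stop e) = stop (≡.trans (old r≢i) e)
  root-kept r≢i (step e ρ) =
    step (≡.trans (old λ where ≡.refl → nothing≢just {f = g} orphan e) e) (root-kept r≢i ρ)

  root-moved : ∀ {p r} → Root g p i → Root g′ q r → Root g′ p r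
  root-moved (stop _)   ρ′ = step new ρ′
  root-moved (step e ρ) ρ′ =
    step (≡.trans (old λ where ≡.refl → nothing≢just {f = g} orphan e) e) (root-moved ρ ρ′)

  root-restrict : ∀ {p r} → Root g′ p r → ∃[ r′ ] Root g p r′
  root-restrict {p} ρ′ with p ≟ i
  ... | yes ≡.refl = i , stop orphan
  root-restrict (stop e)    | no p≢i = _ , stop (≡.trans (≡.sym (old p≢i)) e)
  root-restrict (step e ρ′) | no p≢i with r , ρ ← root-restrict ρ′ =
    r , step (≡.trans (≡.sym (old p≢i)) e) ρ

  -- If q descends from i, the new arc closes a circuit.
  root-lost : Root g q i → ∀ {p r} → Root g p i → ¬ Root g′ p r
  root-lost ρq {p} ρ ρ′ with p ≟ i
  root-lost ρq ρ (stop e)    | yes ≡.refl = nothing≢just {f = g′} e new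
  root-lost ρq ρ (step e ρ′) | yes ≡.refl
    with ≡.refl ← just-injective (≡.trans (≡.sym e) new) = root-lost ρq ρq ρ′
  root-lost ρq (stop _)   _          | no p≢i = p≢i ≡.refl
  root-lost ρq (step e ρ) (stop e′)  | no p≢i =
    nothing≢just {f = g} (≡.trans (≡.sym (old p≢i)) e′) e
  root-lost ρq (step e ρ) (step e′ ρ′) | no p≢i
    with ≡.refl ← just-injective (≡.trans (≡.sym e) (≡.trans (≡.sym (old p≢i)) e′)) = root-lost ρq ρ ρ′

  forest-restrict : Forest g′ → Forest g
  forest-restrict F p = root-restrict (proj₂ (F p))

  forest-extend : Forest g → ¬ Root g q i → Forest g′
  forest-extend F ¬ρq p with F p | F q
  ... | r , ρ | s , σ with r ≟ i
  ... | no r≢i   = r , root-kept r≢i ρ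
  -- The chain from `p` to `i` is continued by the chain from `q`, which is intact because its root
  -- `s` is not `i`.
  ... | yes ≡.refl = s , root-moved ρ (root-kept (λ where ≡.refl → ¬ρq σ) σ)

-- Correspondence between parent functions and out forests

lookup-ext : ∀ {a} {A : Set a} {n} {xs ys : Vec A n} → (∀ i → lookup xs i ≡ lookup ys i) → xs ≡ ys
lookup-ext {xs = xs} {ys} e =
  ≡.trans (≡.sym (tabulate∘lookup xs)) (≡.trans (tabulate-cong e) (tabulate∘lookup ys))

digraph-ext : ∀ {n} {F G : Digraph n} →
              (∀ {i j} → Arc F i j → Arc G i j) → (∀ {i j} → Arc G i j → Arc F i j) → F ≡ G
digraph-ext {F = F} {G} F⊆G G⊆F = lookup-ext λ i → lookup-ext (same i)
  where
  same : ∀ i j → lookup (lookup F i) j ≡ lookup (lookup G i) j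
  same i j with lookup (lookup F i) j in eF | lookup (lookup G i) j in eG
  ... | true  | true  = ≡.refl
  ... | false | false = ≡.refl
  ... | true  | false = ≡.trans (≡.sym ([]=⇒lookup (F⊆G (lookup⇒[]= j _ eF)))) eG
  ... | false | true  = ≡.trans (≡.sym eF) ([]=⇒lookup (G⊆F (lookup⇒[]= j _ eG)))

toDigraph-injective : ∀ {n} {f g : Parents n} → toDigraph f ≡ toDigraph g → f ≡ g
toDigraph-injective {f = f} {g} e = lookup-ext same
  where
  same : ∀ j → lookup f j ≡ lookup g j
  same j with lookup f j in ef | lookup g j in eg
  ... | nothing | nothing = ≡.refl
  ... | just p  | _       =
    ≡.trans (≡.sym (arc⇒parent {f = g} (subst (λ G → Arc G p j) e (parent⇒arc {f = f} ef)))) eg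
  ... | nothing | just q  =
    ≡.trans (≡.sym ef) (arc⇒parent {f = f} (subst (λ G → Arc G q j) (≡.sym e) (parent⇒arc {f = g} eg)))

unique∧constant⇒length≤1 : ∀ {a} {A : Set a} {xs : List A} → Unique xs →
  (∀ {x y} → x ∈ₗ xs → y ∈ₗ xs → x ≡ y) → length xs ℕ.≤ 1
unique∧constant⇒length≤1 {xs = []}        _ _ = z≤n
unique∧constant⇒length≤1 {xs = x ∷ []}    _ _ = s≤s z≤n
unique∧constant⇒length≤1 {xs = x ∷ y ∷ _} ((x≢y ∷ _) ∷ _) const =
  contradiction (const (here ≡.refl) (there (here ≡.refl))) x≢y

toDigraph-indegree : ∀ {n} (f : Parents n) j → indegree (toDigraph f) j ℕ.≤ 1
toDigraph-indegree {n} f j =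
  unique∧constant⇒length≤1 (Unique.filter⁺ _ (Unique.allFin⁺ n)) λ x∈ y∈ →
    just-injective (≡.trans (≡.sym (arc⇒parent {f = f} (proj₂ (∈-filter⁻ _ {xs = allFin n} x∈))))
                          (arc⇒parent {f = f} (proj₂ (∈-filter⁻ _ {xs = allFin n} y∈))))

toDigraph-isDivergingForest : ∀ {n} {f : Parents n} → Forest f → IsDivergingForest (toDigraph f)
toDigraph-isDivergingForest {f = f} F = forest⇒acyclic F , toDigraph-indegree f

module _ {n} (F : Digraph n) where

  -- `head` selects the only in-neighbour, if there is one; no arc is lost when all indegrees are at
  -- most 1.
  fromDigraph : Parents n
  fromDigraph = tabulate λ j → head (filter (λ i → arc? F i j) (allFin n))

  toDigraph-fromDigraph : (∀ j → indegree F j ℕ.≤ 1) → toDigraph fromDigraph ≡ F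
  toDigraph-fromDigraph indegree≤1 = digraph-ext
    (λ a → parent→arc (arc⇒parent {f = fromDigraph} a))
    (λ a → parent⇒arc {f = fromDigraph} (arc→parent a))
    where
    head⁻ : ∀ {xs : List (Fin n)} {x} → head xs ≡ just x → x ∈ₗ xs
    head⁻ {x ∷ xs} ≡.refl = here ≡.refl

    head⁺ : ∀ {xs : List (Fin n)} {x} → length xs ℕ.≤ 1 → x ∈ₗ xs → head xs ≡ just x
    head⁺ _       (here ≡.refl) = ≡.refl
    head⁺ (s≤s ()) (there (here _))
    head⁺ (s≤s ()) (there (there _))

    parent→arc : ∀ {i j} → lookup fromDigraph j ≡ just i → Arc F i j
    parent→arc {i} {j} e =
      proj₂ (∈-filter⁻ _ {xs = allFin n} (head⁻ (≡.trans (≡.sym (lookup∘tabulate _ j)) e)))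

    arc→parent : ∀ {i j} → Arc F i j → lookup fromDigraph j ≡ just i
    arc→parent {i} {j} a =
      ≡.trans (lookup∘tabulate _ j) (head⁺ (indegree≤1 j) (∈-filter⁺ _ (∈-allFin i) a))

parentChoices : ∀ n → List (Maybe (Fin n))
parentChoices n = nothing ∷ map just (allFin n)

parents : ∀ n → List (Parents n)
parents n = vectors (parentChoices n) n

∈-parents : ∀ {n} (f : Parents n) → f ∈ₗ parents n
∈-parents = ∈-vectors λ where
  nothing  → here ≡.refl
  (just p) → there (∈-map⁺ just (∈-allFin p))

parents-unique : ∀ n → Unique (parents n)
parents-unique n = vectors-unique
  (All.tabulate fresh ∷ Unique.map⁺ just-injective (Unique.allFin⁺ n)) n
  where
  fresh : ∀ {x} → x ∈ₗ map just (allFin n) → nothing ≢ x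
  fresh x∈ ≡.refl with () ← proj₂ (proj₂ (∈-map⁻ just x∈))

isOutForestWithArcs? : ∀ {n} (G : Digraph n) k F → Dec (IsOutForest G F × numArcs F ≡ k)
isOutForestWithArcs? G k F = isOutForest? G F ×-dec numArcs F ℕ.≟ k

-- Both lists are free of repetitions, so having the same members makes them permutations of each
-- other, which is enough to compare sums over them.
outForests-↭ : ∀ {n} (G : Digraph n) k →
  outForests G k ↭ map toDigraph (filter (isOutForestWithArcs? G k ∘ toDigraph) (parents n))
outForests-↭ {n} G k = ∼bag⇒↭ (unique∧set⇒bag
  (Unique.filter⁺ _ (digraphs-unique n))
  (Unique.map⁺ toDigraph-injective (Unique.filter⁺ _ (parents-unique n)))
  (mk⇔ to from))
  where
  to : ∀ {F} → F ∈ₗ outForests G k →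
       F ∈ₗ map toDigraph (filter (isOutForestWithArcs? G k ∘ toDigraph) (parents n))
  to {F} F∈ with _ , p ← ∈-filter⁻ (isOutForestWithArcs? G k) {xs = digraphs n} F∈ =
    subst (_∈ₗ map toDigraph _) e
      (∈-map⁺ toDigraph (∈-filter⁺ _ (∈-parents (fromDigraph F))
        (subst (λ F → IsOutForest G F × numArcs F ≡ k) (≡.sym e) p)))
    where
    e : toDigraph (fromDigraph F) ≡ F
    e = toDigraph-fromDigraph F (IsDivergingForest.indegree≤1 (proj₂ (proj₁ p)))

  from : ∀ {F} → F ∈ₗ map toDigraph (filter (isOutForestWithArcs? G k ∘ toDigraph) (parents n)) →
         F ∈ₗ outForests G k
  from F∈ with f , f∈ , ≡.refl ← ∈-map⁻ toDigraph F∈ =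
    ∈-filter⁺ _ (∈-digraphs (toDigraph f))
      (proj₂ (∈-filter⁻ (isOutForestWithArcs? G k ∘ toDigraph) {xs = parents n} f∈))

-- Roots and weak components

module _ {n} (f : Parents n) where

  orphan? : ∀ p → Dec (lookup f p ≡ nothing)
  orphan? p = ≡-dec _≟_ (lookup f p) nothing

  orphans : List (Fin n)
  orphans = filter orphan? (allFin n)

  ∈-orphans : ∀ {p} → lookup f p ≡ nothing → p ∈ₗ orphans
  ∈-orphans {p} e = ∈-filter⁺ _ (∈-allFin p) e

  -- Each tree of a forest contains exactly one root.
  forest-weakComponents : Forest f → HasWeakComponents (toDigraph f) (length orphans)
  forest-weakComponents F = record
    { to        = to
    ; cong      = λ w → position-cong (components-root w)
    ; bijective = (λ e → connected (position-injective e))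
                , λ k → List.lookup orphans k , λ w → ≡.trans (position-cong (components-root w)) (to-root k)
    }
    where
    root : Fin n → Fin n
    root p = proj₁ (F p)

    position : ∀ p → lookup f p ≡ nothing → Fin (length orphans)
    position p e = Any.index (∈-orphans e)

    orphan-root : ∀ p → lookup f (root p) ≡ nothing
    orphan-root p = root-orphan (proj₂ (F p))

    to : Fin n → Fin (length orphans)
    to p = position (root p) (orphan-root p)

    -- A position is read off a membership proof. As `orphans` has no repetitions, that proof is
    -- unique and the position depends on the root alone.
    irrelevant : ∀ {p} (x y : p ∈ₗ orphans) → x ≡ y
    irrelevant = unique⇒irrelevant (Unique.filter⁺ _ (Unique.allFin⁺ n))

    position-cong : ∀ {p q e e′} → p ≡ q → position p e ≡ position q e′
    position-cong ≡.refl = cong Any.index (irrelevant _ _)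

    position-injective : ∀ {p q e e′} → position p e ≡ position q e′ → p ≡ q
    position-injective = ∈-Setoid.index-injective (≡.setoid (Fin n)) (∈-orphans _) (∈-orphans _)

    components-root : ∀ {p q} → EqClosure (Arc (toDigraph f)) p q → root p ≡ root q
    components-root = Equivalence.gfold ≡.isEquivalence root λ {p} {q} a →
      ≡.sym (root-unique (proj₂ (F q)) (step (arc⇒parent {f = f} a) (proj₂ (F p))))

    toRoot : ∀ {p r} → Root f p r → EqClosure (Arc (toDigraph f)) p r
    toRoot (stop _)   = Equivalence.reflexive _
    toRoot (step e ρ) = Equivalence.transitive _
      (Equivalence.symmetric _ (Equivalence.return (parent⇒arc {f = f} e))) (toRoot ρ)

    connected : ∀ {p q} → root p ≡ root q → EqClosure (Arc (toDigraph f)) p q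
    connected {p} {q} e = Equivalence.transitive _ (toRoot (proj₂ (F p)))
      (Equivalence.symmetric _ (toRoot (subst (Root f q) (≡.sym e) (proj₂ (F q)))))

    to-root : ∀ k → to (List.lookup orphans k) ≡ k
    to-root k = ≡.trans
      (position-cong {e′ = o} (root-unique (proj₂ (F _)) (stop o)))
      (≡.trans (cong Any.index (irrelevant (∈-orphans o) (∈-lookup k))) (index-∈-lookup orphans k))
      where
      o : lookup f (List.lookup orphans k) ≡ nothing
      o = proj₂ (∈-filter⁻ orphan? {xs = allFin n} (∈-lookup k))

      index-∈-lookup : ∀ (xs : List (Fin n)) k → Any.index (∈-lookup {xs = xs} k) ≡ k
      index-∈-lookup (x ∷ xs) Fin.zero    = ≡.refl
      index-∈-lookup (x ∷ xs) (Fin.suc k) = cong Fin.suc (index-∈-lookup xs k)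

-- Finite sums and products in a commutative monoid

module CommutativeMonoidFolds {a ℓ} (M : CommutativeMonoid a ℓ) where

  open CommutativeMonoid M
  open CommutativeMonoidSum M public
  import Relation.Binary.Reasoning.Setoid setoid as ≈-Reasoning

  fold : ∀ {b} {B : Set b} → (B → Carrier) → List B → Carrier
  fold h xs = foldr _∙_ ε (map h xs)

  module _ {b} {B : Set b} where

    fold-cong : ∀ {h h′ : B → Carrier} → (∀ x → h x ≈ h′ x) → ∀ xs → fold h xs ≈ fold h′ xs
    fold-cong e []       = refl
    fold-cong e (x ∷ xs) = ∙-cong (e x) (fold-cong e xs)

    fold-++ : ∀ (h : B → Carrier) xs ys → fold h (xs ++ ys) ≈ fold h xs ∙ fold h ys
    fold-++ h []       ys = sym (identityˡ _)
    fold-++ h (x ∷ xs) ys = trans (∙-congˡ (fold-++ h xs ys)) (sym (assoc _ _ _))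

    fold-map : ∀ {c} {C : Set c} (h : B → Carrier) (g : C → B) xs →
               fold h (map g xs) ≡ fold (h ∘ g) xs
    fold-map h g xs = cong (foldr _∙_ ε) (≡.sym (List.map-∘ xs))

    fold-filter : ∀ {p} {P : Pred B p} (P? : Decidable P) (h : B → Carrier) xs →
                  fold h (filter P? xs) ≈ fold (λ x → if does (P? x) then h x else ε) xs
    fold-filter P? h []       = refl
    fold-filter P? h (x ∷ xs) with does (P? x)
    ... | true  = ∙-congˡ (fold-filter P? h xs)
    ... | false = trans (fold-filter P? h xs) (sym (identityˡ _))

    fold-↭ : ∀ (h : B → Carrier) {xs ys} → xs ↭ ys → fold h xs ≈ fold h ys
    fold-↭ h _↭_.refl         = refl
    fold-↭ h (prep x p)       = ∙-congˡ (fold-↭ h p)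
    fold-↭ h (swap x y p)     =
      trans (sym (assoc _ _ _)) (trans (∙-cong (comm _ _) (fold-↭ h p)) (assoc _ _ _))
    fold-↭ h (_↭_.trans p q)  = trans (fold-↭ h p) (fold-↭ h q)

    fold-cartesianProductWith : ∀ {c d} {C : Set c} {D : Set d} (f : C → D → B) (h : B → Carrier) xs ys →
      fold h (cartesianProductWith f xs ys) ≈ fold (λ x → fold (λ y → h (f x y)) ys) xs
    fold-cartesianProductWith f h []       ys = refl
    fold-cartesianProductWith f h (x ∷ xs) ys = trans (fold-++ h (map (f x) ys) _)
      (∙-cong (reflexive (fold-map h (f x) ys)) (fold-cartesianProductWith f h xs ys))

  fold-allFin : ∀ {n} (h : Fin n → Carrier) → fold h (allFin n) ≡ sum h
  fold-allFin {zero}  h = ≡.refl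
  fold-allFin {suc n} h = cong (h Fin.zero ∙_) (≡.trans
    (cong (fold h) (≡.sym (List.map-tabulate (λ i → i) Fin.suc)))
    (≡.trans (fold-map h Fin.suc (allFin n)) (fold-allFin (h ∘ Fin.suc))))

  sum-zero : ∀ {n} {t : Fin n → Carrier} → (∀ i → t i ≈ ε) → sum t ≈ ε
  sum-zero {n} e = trans (sum-cong-≋ e) (sum-replicate-zero n)

  sum-single : ∀ {n} p {t : Fin n → Carrier} → (∀ i → i ≢ p → t i ≈ ε) → sum t ≈ t p
  sum-single {suc n} p {t} e = trans (sum-remove {i = p} t)
    (trans (∙-congˡ (sum-zero λ i → e (punchIn p i) (punchInᵢ≢i p i))) (identityʳ _))

  -- The old entry at `i` contributes `ε`, so the update only adds a contribution. Additively this
  -- counts the arcs after `i` gets a parent, multiplicatively it gives the weight.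
  sum-update : ∀ {b} {B : Set b} {n} (h : B → Fin n → Carrier) (xs : Vec B n) i x →
    h (lookup xs i) i ≈ ε →
    sum (λ j → h (lookup (xs [ i ]≔ x) j) j) ≈ h x i ∙ sum (λ j → h (lookup xs j) j)
  sum-update {n = suc n} h xs i x e = begin
    sum (λ j → h (lookup (xs [ i ]≔ x) j) j)
      ≈⟨ sum-remove {i = i} (λ j → h (lookup (xs [ i ]≔ x) j) j) ⟩
    h (lookup (xs [ i ]≔ x) i) i ∙ sum (λ j → h (lookup (xs [ i ]≔ x) (punchIn i j)) (punchIn i j))
      ≈⟨ ∙-cong (reflexive (cong (λ y → h y i) (lookup∘update i xs x)))
                (sum-cong-≋ λ j → reflexive (cong (λ y → h y (punchIn i j))
                  (lookup∘update′ (punchInᵢ≢i i j) xs x))) ⟩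
    h x i ∙ sum (λ j → h (lookup xs (punchIn i j)) (punchIn i j))
      ≈⟨ ∙-congˡ (trans (∙-congʳ e) (identityˡ _)) ⟨
    h x i ∙ (h (lookup xs i) i ∙ sum (λ j → h (lookup xs (punchIn i j)) (punchIn i j)))
      ≈⟨ ∙-congˡ (sum-remove {i = i} (λ j → h (lookup xs j) j)) ⟨
    h x i ∙ sum (λ j → h (lookup xs j) j) ∎
    where open ≈-Reasoning

  -- After exchanging the sums, the heads `j` are outermost, and the only arc into `j` is the one
  -- from its parent. The addition of natural numbers yields the number of arcs, the multiplication
  -- of weights the weight.
  fold-arcs : ∀ {n} (h : Fin n × Fin n → Carrier) (f : Parents n) →
    fold h (arcs (toDigraph f)) ≈ sum (λ j → maybe (λ p → h (p , j)) ε (lookup f j))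
  fold-arcs {n} h f = begin
    fold h (arcs G)
      ≈⟨ fold-filter _ h (cartesianProduct (allFin n) (allFin n)) ⟩
    fold h′ (cartesianProduct (allFin n) (allFin n))
      ≈⟨ fold-cartesianProductWith _,_ h′ (allFin n) (allFin n) ⟩
    fold (λ i → fold (λ j → h′ (i , j)) (allFin n)) (allFin n)
      ≡⟨ fold-allFin (λ i → fold (λ j → h′ (i , j)) (allFin n)) ⟩
    sum (λ i → fold (λ j → h′ (i , j)) (allFin n))
      ≈⟨ sum-cong-≋ (λ i → reflexive (fold-allFin (λ j → h′ (i , j)))) ⟩
    sum (λ i → sum (λ j → h′ (i , j)))
      ≈⟨ ∑-comm (λ i j → h′ (i , j)) ⟩
    sum (λ j → sum (λ i → h′ (i , j)))
      ≈⟨ sum-cong-≋ column ⟩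
    sum (λ j → maybe (λ p → h (p , j)) ε (lookup f j)) ∎
    where
    open ≈-Reasoning
    G  = toDigraph f
    h′ = λ (e : Fin n × Fin n) → if does (arc? G (proj₁ e) (proj₂ e)) then h e else ε

    column : ∀ j → sum (λ i → h′ (i , j)) ≈ maybe (λ p → h (p , j)) ε (lookup f j)
    column j = go (lookup f j) ≡.refl
      where
      absent : ∀ {i} → lookup f j ≢ just i → h′ (i , j) ≈ ε
      absent {i} ne with arc? G i j
      ... | yes a = contradiction (arc⇒parent {f = f} a) ne
      ... | no  _ = refl
      present : ∀ {i} → lookup f j ≡ just i → h′ (i , j) ≈ h (i , j)
      present {i} e with arc? G i j
      ... | yes _ = refl
      ... | no ¬a = contradiction (parent⇒arc {f = f} e) ¬a
      go : ∀ x → lookup f j ≡ x → sum (λ i → h′ (i , j)) ≈ maybe (λ p → h (p , j)) ε x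
      go nothing  e = sum-zero {t = λ i → h′ (i , j)} λ i → absent λ e′ → nothing≢just {f = f} e e′
      go (just p) e = trans
        (sum-single p {λ i → h′ (i , j)} λ i i≢p → absent λ e′ → i≢p (just-injective (≡.trans (≡.sym e′) e)))
        (present e)

-- Counting the arcs of a forest

module ℕ-Folds = CommutativeMonoidFolds ℕ.+-0-commutativeMonoid

length≡fold : ∀ {a} {A : Set a} (xs : List A) → length xs ≡ ℕ-Folds.fold (const 1) xs
length≡fold []       = ≡.refl
length≡fold (x ∷ xs) = cong suc (length≡fold xs)

count : ∀ {n} → Parents n → ℕ
count f = ℕ-Folds.sum (λ j → maybe (const 1) 0 (lookup f j))

numArcs-toDigraph : ∀ {n} (f : Parents n) → numArcs (toDigraph f) ≡ count f
numArcs-toDigraph f = ≡.trans (length≡fold (arcs (toDigraph f))) (ℕ-Folds.fold-arcs (const 1) f)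

count-update : ∀ {n} (g : Parents n) i → lookup g i ≡ nothing → ∀ q → count (g [ i ]≔ just q) ≡ suc (count g)
count-update g i orphan q =
  ℕ-Folds.sum-update (λ x _ → maybe (const 1) 0 x) g i (just q) (cong (maybe (const 1) 0) orphan)

-- Each vertex is either a root or the head of exactly one arc.
orphans-count : ∀ {n} (f : Parents n) → length (orphans f) ℕ.+ count f ≡ n
orphans-count {n} f = begin
  length (orphans f) ℕ.+ count f
    ≡⟨ cong (ℕ._+ count f) (begin
         length (orphans f)         ≡⟨ length≡fold (orphans f) ⟩
         fold (const 1) (orphans f) ≡⟨ fold-filter (orphan? f) (const 1) (allFin n) ⟩
         fold isRoot (allFin n)     ≡⟨ fold-allFin isRoot ⟩
         sum isRoot                 ∎) ⟩
  sum isRoot ℕ.+ count f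
    ≡⟨ ∑-distrib-+ isRoot (λ j → maybe (const 1) 0 (lookup f j)) ⟨
  sum (λ j → isRoot j ℕ.+ maybe (const 1) 0 (lookup f j))
    ≡⟨ sum-cong-≗ one ⟩
  sum {n} (const 1)
    ≡⟨ ones n ⟩
  n ∎
  where
  open ≡.≡-Reasoning
  open ℕ-Folds
  isRoot : Fin n → ℕ
  isRoot j = if does (orphan? f j) then 1 else 0
  one : ∀ j → isRoot j ℕ.+ maybe (const 1) 0 (lookup f j) ≡ 1
  one j with lookup f j
  ... | nothing = ≡.refl
  ... | just _  = ≡.refl
  ones : ∀ n → sum {n} (const 1) ≡ n
  ones zero    = ≡.refl
  ones (suc n) = cong suc (ones n)

-- The roots number the weak components, so the minimality of `v` bounds them from below;
-- `orphans-count` turns this into an upper bound on the arcs.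
outForest-size : ∀ {n} {G : Digraph n} {v} → IsOutForestDimension G v →
  ∀ {f} → Forest f → SpanningSubgraph (toDigraph f) G → count f ℕ.+ v ℕ.≤ n
outForest-size {n} dim {f} F sub = ℕ.≤-trans
  (ℕ.+-monoʳ-≤ (count f) (IsOutForestDimension.minimal dim _ _
    (sub , toDigraph-isDivergingForest F) (forest-weakComponents f F)))
  (ℕ.≤-reflexive (≡.trans (ℕ.+-comm (count f) _) (orphans-count f)))

-- Sums in a commutative semiring

module Summation {a ℓ} (R : CommutativeSemiring a ℓ) where

  open CommutativeSemiring R
  private
    module Σ = CommutativeMonoidFolds +-commutativeMonoid
    module Σ* = SemiringSum semiring

  -- Abstract, so that unification can recover the summand of a sum.
  abstract

    ∑ : ∀ {m} → (Fin m → Carrier) → Carrier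
    ∑ = Σ.sum

    ∑≡sum : ∀ {m} (t : Fin m → Carrier) → ∑ t ≡ Σ.sum t
    ∑≡sum t = ≡.refl

    ∑-suc : ∀ {m} (t : Fin (suc m) → Carrier) → ∑ t ≡ t Fin.zero + ∑ (t ∘ Fin.suc)
    ∑-suc t = ≡.refl

    ∑-cong : ∀ {m} {s t : Fin m → Carrier} → (∀ i → s i ≈ t i) → ∑ s ≈ ∑ t
    ∑-cong = Σ.sum-cong-≋

    ∑-zero : ∀ {m} {t : Fin m → Carrier} → (∀ i → t i ≈ 0#) → ∑ t ≈ 0#
    ∑-zero = Σ.sum-zero

    ∑-+ : ∀ {m} (s t : Fin m → Carrier) → ∑ (λ i → s i + t i) ≈ ∑ s + ∑ t
    ∑-+ = Σ.∑-distrib-+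

    ∑-*ˡ : ∀ {m} c (t : Fin m → Carrier) → ∑ (λ i → c * t i) ≈ c * ∑ t
    ∑-*ˡ c t = sym (Σ*.*-distribˡ-sum c t)

    ∑-pull : ∀ {m} {s t : Fin m → Carrier} c → (∀ i → s i ≈ c * t i) → ∑ s ≈ c * ∑ t
    ∑-pull {t = t} c e = trans (∑-cong e) (∑-*ˡ c t)

    ∑-comm : ∀ {l m} (t : Fin l → Fin m → Carrier) → ∑ (λ i → ∑ (t i)) ≈ ∑ (λ j → ∑ (λ i → t i j))
    ∑-comm = Σ.∑-comm

    ∑-single : ∀ {m} p {t : Fin m → Carrier} → (∀ i → i ≢ p → t i ≈ 0#) → ∑ t ≈ t p
    ∑-single = Σ.sum-single

-- Weighted sums over parent functions and their recurrence

module ForestSums {a ℓ} (R : CommutativeSemiring a ℓ) {n} (ε : Fin n → Fin n → CommutativeSemiring.Carrier R) where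

  open CommutativeSemiring R
  open Summation R
  open CommutativeMonoidFolds +-commutativeMonoid using (fold; fold-cartesianProductWith; fold-map; fold-allFin)
  open SemiringSolver R using (solve; _:+_; _:*_; _:=_)
  open import Relation.Binary.Reasoning.Setoid setoid hiding (stop)
  private module ∏ = CommutativeMonoidFolds *-commutativeMonoid

  -- The Iverson bracket, which turns conditions on forests into factors. In particular `⟦ i ≟ j ⟧`
  -- is an entry of the identity matrix.
  ⟦_⟧ : ∀ {p} {P : Set p} → Dec P → Carrier
  ⟦ d ⟧ = if does d then 1# else 0#

  module _ {p} {P : Set p} where

    ⟦⟧-true : (d : Dec P) → P → ⟦ d ⟧ ≡ 1#
    ⟦⟧-true d x = cong (if_then 1# else 0#) (dec-true d x)

    ⟦⟧-false : (d : Dec P) → ¬ P → ⟦ d ⟧ ≡ 0#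
    ⟦⟧-false d ¬x = cong (if_then 1# else 0#) (dec-false d ¬x)

    ⟦⟧-⇔ : ∀ {q} {Q : Set q} (d : Dec P) (d′ : Dec Q) → (P → Q) → (Q → P) → ⟦ d ⟧ ≡ ⟦ d′ ⟧
    ⟦⟧-⇔ d d′ to from = cong (if_then 1# else 0#) (does-⇔ (mk⇔ to from) d d′)

  ⟦⟧*≈0 : ∀ {p} {P : Set p} {x} (d : Dec P) → (P → x ≈ 0#) → ⟦ d ⟧ * x ≈ 0#
  ⟦⟧*≈0 (yes p) x≈0 = trans (*-congˡ (x≈0 p)) (zeroʳ 1#)
  ⟦⟧*≈0 (no _)  _   = zeroˡ _

  -- An iterated sum over the entries, in place of a fold over a list of vectors, lets any single
  -- entry be singled out by recursion on its index.
  sumᵛ : ∀ k → (Vec (Maybe (Fin n)) k → Carrier) → Carrier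
  sumᵛ zero    φ = φ []
  sumᵛ (suc k) φ = sumᵛ k (λ f → φ (nothing ∷ f)) + ∑ (λ p → sumᵛ k (λ f → φ (just p ∷ f)))

  sumᵛ-cong : ∀ k {φ ψ} → (∀ f → φ f ≈ ψ f) → sumᵛ k φ ≈ sumᵛ k ψ
  sumᵛ-cong zero    e = e []
  sumᵛ-cong (suc k) e =
    +-cong (sumᵛ-cong k λ f → e _) (∑-cong λ p → sumᵛ-cong k λ f → e _)

  sumᵛ-+ : ∀ k φ ψ → sumᵛ k (λ f → φ f + ψ f) ≈ sumᵛ k φ + sumᵛ k ψ
  sumᵛ-+ zero    φ ψ = refl
  sumᵛ-+ (suc k) φ ψ = begin
    sumᵛ (suc k) (λ f → φ f + ψ f)
      ≈⟨ +-cong (sumᵛ-+ k _ _) (trans (∑-cong λ p → sumᵛ-+ k _ _) (∑-+ _ _)) ⟩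
    (a₁ + b₁) + (a₂ + b₂)
      ≈⟨ solve 4 (λ a₁ b₁ a₂ b₂ → (a₁ :+ b₁) :+ (a₂ :+ b₂) := (a₁ :+ a₂) :+ (b₁ :+ b₂)) refl a₁ b₁ a₂ b₂ ⟩
    sumᵛ (suc k) φ + sumᵛ (suc k) ψ ∎
    where
    a₁ = sumᵛ k (λ f → φ (nothing ∷ f))
    b₁ = sumᵛ k (λ f → ψ (nothing ∷ f))
    a₂ = ∑ (λ p → sumᵛ k (λ f → φ (just p ∷ f)))
    b₂ = ∑ (λ p → sumᵛ k (λ f → ψ (just p ∷ f)))

  sumᵛ-*ˡ : ∀ k c φ → sumᵛ k (λ f → c * φ f) ≈ c * sumᵛ k φ
  sumᵛ-*ˡ zero    c φ = refl
  sumᵛ-*ˡ (suc k) c φ = trans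
    (+-cong (sumᵛ-*ˡ k c _) (trans (∑-cong λ p → sumᵛ-*ˡ k c _) (∑-*ˡ c _)))
    (sym (distribˡ c _ _))

  sumᵛ-zero : ∀ k {φ} → (∀ f → φ f ≈ 0#) → sumᵛ k φ ≈ 0#
  sumᵛ-zero zero    e = e []
  sumᵛ-zero (suc k) e = trans
    (+-cong (sumᵛ-zero k λ f → e _) (∑-zero λ p → sumᵛ-zero k λ f → e _)) (+-identityˡ 0#)

  sumᵛ-sum : ∀ k {m} (φ : Fin m → _ → Carrier) →
             sumᵛ k (λ f → ∑ (λ p → φ p f)) ≈ ∑ (λ p → sumᵛ k (φ p))
  sumᵛ-sum k {zero}  φ = trans (sumᵛ-zero k λ f → ∑-zero λ ()) (sym (∑-zero λ ()))
  sumᵛ-sum k {suc m} φ = begin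
    sumᵛ k (λ f → ∑ (λ p → φ p f))
      ≈⟨ sumᵛ-cong k (λ f → reflexive (∑-suc (λ p → φ p f))) ⟩
    sumᵛ k (λ f → φ Fin.zero f + ∑ (λ p → φ (Fin.suc p) f))
      ≈⟨ sumᵛ-+ k _ _ ⟩
    sumᵛ k (φ Fin.zero) + sumᵛ k (λ f → ∑ (λ p → φ (Fin.suc p) f))
      ≈⟨ +-congˡ (sumᵛ-sum k (λ p → φ (Fin.suc p))) ⟩
    sumᵛ k (φ Fin.zero) + ∑ (λ p → sumᵛ k (φ (Fin.suc p)))
      ≡⟨ ∑-suc (λ p → sumᵛ k (φ p)) ⟨
    ∑ (λ p → sumᵛ k (φ p)) ∎

  sumᵛ-vectors : ∀ k (φ : Vec (Maybe (Fin n)) k → Carrier) → fold φ (vectors (parentChoices n) k) ≈ sumᵛ k φ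
  sumᵛ-vectors zero    φ = +-identityʳ (φ [])
  sumᵛ-vectors (suc k) φ = trans
    (fold-cartesianProductWith _∷_ φ (parentChoices n) (vectors (parentChoices n) k))
    (+-cong (sumᵛ-vectors k (λ f → φ (nothing ∷ f))) (begin
      fold φ′ (map just (allFin n))     ≡⟨ fold-map φ′ just (allFin n) ⟩
      fold (φ′ ∘ just) (allFin n)       ≡⟨ ≡.trans (fold-allFin (φ′ ∘ just)) (≡.sym (∑≡sum (φ′ ∘ just))) ⟩
      ∑ (φ′ ∘ just)                     ≈⟨ ∑-cong (λ p → sumᵛ-vectors k (λ f → φ (just p ∷ f))) ⟩
      ∑ (λ p → sumᵛ k (λ f → φ (just p ∷ f))) ∎))
    where
    φ′ : Maybe (Fin n) → Carrier
    φ′ x = fold (λ f → φ (x ∷ f)) (vectors (parentChoices n) k)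

  -- For g with g i ≡ nothing, the sum of φ over the vectors that agree with g
  -- off i.
  fibre : ∀ {k} → (Vec (Maybe (Fin n)) k → Carrier) → Fin k → Vec (Maybe (Fin n)) k → Carrier
  fibre φ i g = φ g + ∑ (λ p → φ (g [ i ]≔ just p))

  -- Forgetting entry `i` partitions the vectors into fibres, each with one member `g` that has
  -- `nothing` there. Regrouping happens only at the first entry; for a later `i` the first entry is
  -- fixed and the hypothesis is passed on.
  sumᵛ-fibre : ∀ {k} φ ψ i →
    (∀ g → lookup g i ≡ nothing → fibre φ i g ≈ fibre ψ i g) → sumᵛ k φ ≈ sumᵛ k ψ
  sumᵛ-fibre {suc k} φ ψ Fin.zero    e = begin
    sumᵛ (suc k) φ                             ≈⟨ +-congˡ (sumᵛ-sum k _) ⟨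
    sumᵛ k (λ f → φ (nothing ∷ f)) + sumᵛ k _  ≈⟨ sumᵛ-+ k _ _ ⟨
    sumᵛ k (λ f → fibre φ Fin.zero (nothing ∷ f)) ≈⟨ sumᵛ-cong k (λ f → e (nothing ∷ f) ≡.refl) ⟩
    sumᵛ k (λ f → fibre ψ Fin.zero (nothing ∷ f)) ≈⟨ sumᵛ-+ k _ _ ⟩
    sumᵛ k (λ f → ψ (nothing ∷ f)) + sumᵛ k _  ≈⟨ +-congˡ (sumᵛ-sum k _) ⟩
    sumᵛ (suc k) ψ                             ∎
  sumᵛ-fibre {suc k} φ ψ (Fin.suc i) e = +-cong
    (sumᵛ-fibre _ _ i λ g o → e (nothing ∷ g) o)
    (∑-cong λ p → sumᵛ-fibre _ _ i λ g o → e (just p ∷ g) o)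

  arcFactor : Maybe (Fin n) → Fin n → Carrier
  arcFactor x j = maybe (λ p → ε p j) 1# x

  parentWeight : Parents n → Carrier
  parentWeight f = ∏.sum (λ j → arcFactor (lookup f j) j)

  -- Being a subgraph is expressed by `parentWeight`: if `ε` vanishes off the arcs, so does the
  -- weight of any `f` that uses a non-arc.
  forestTerm : ℕ → Parents n → Carrier
  forestTerm k f = ⟦ count f ℕ.≟ k ⟧ * (⟦ forest? f ⟧ * parentWeight f)

  rootedTerm : ℕ → Fin n → Fin n → Parents n → Carrier
  rootedTerm k p r f = ⟦ count f ℕ.≟ k ⟧ * (⟦ rootedForest? f p r ⟧ * parentWeight f)

  forestSum : ℕ → Carrier
  forestSum k = sumᵛ n (forestTerm k)

  -- The (p , r) entry of Qₖ.
  rootedSum : ℕ → Fin n → Fin n → Carrier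
  rootedSum k p r = sumᵛ n (rootedTerm k p r)

  -- For a forest g with root i and p ↦ root of p in g: α and β indicate that
  -- this root is i and j, ᾱ is 1 - α, δ is the Kronecker delta of i and j, w
  -- is the weight of g, and u₁, u₀, u₂ indicate that g has k + 1, k and k - 1
  -- arcs.  With ᾱ instead of subtraction the identity holds in semirings.
  module FibreIdentity (i : Fin n) {u₀ u₁ u₂ w δ : Carrier} {e α ᾱ β : Fin n → Carrier}
    (α+ᾱ : ∀ p → α p + ᾱ p ≈ 1#) (αβ : ∀ p → α p * β p ≈ δ * α p)
    (αᵢ : α i ≈ 1#) (ᾱᵢ : ᾱ i ≈ 0#) (βᵢ : β i ≈ δ) where

    Eα = ∑ (λ p → e p * α p)
    Eᾱ = ∑ (λ p → e p * ᾱ p)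
    Eᾱβ = ∑ (λ p → e p * (ᾱ p * β p))

    -- Indicates that a forest results when `i` gets the parent `r`, and that `p` then has root `j`:
    -- descendants of `i` take over the root of `r`, other vertices keep theirs.
    moved : Fin n → Fin n → Carrier
    moved r p = ᾱ r * (α p * β r + ᾱ p * β p)

    split : ∀ x p → x ≈ x * α p + x * ᾱ p
    split x p = trans (sym (*-identityʳ x)) (trans (*-congˡ (sym (α+ᾱ p))) (distribˡ x _ _))

    e-split : ∑ e ≈ Eα + Eᾱ
    e-split = trans (∑-cong λ p → split (e p) p) (∑-+ _ _)

    eβ-split : ∑ (λ p → e p * β p) ≈ δ * Eα + Eᾱβ
    eβ-split = begin
      ∑ (λ p → e p * β p)
        ≈⟨ ∑-cong (λ p → begin
             e p * β p                              ≈⟨ *-congˡ (split (β p) p) ⟩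
             e p * (β p * α p + β p * ᾱ p)          ≈⟨ *-congˡ (+-cong (trans (*-comm _ _) (αβ p)) (*-comm _ _)) ⟩
             e p * (δ * α p + ᾱ p * β p)            ≈⟨ solve 4 (λ e d a b → e :* (d :* a :+ b) := d :* (e :* a) :+ e :* b)
                                                         refl (e p) δ (α p) (ᾱ p * β p) ⟩
             δ * (e p * α p) + e p * (ᾱ p * β p)    ∎) ⟩
      ∑ (λ p → δ * (e p * α p) + e p * (ᾱ p * β p))
        ≈⟨ ∑-+ _ _ ⟩
      ∑ (λ p → δ * (e p * α p)) + Eᾱβ
        ≈⟨ +-congʳ (∑-*ˡ δ _) ⟩
      δ * Eα + Eᾱβ ∎

    movedᵢ : ∀ r → moved r i ≈ ᾱ r * β r
    movedᵢ r = *-congˡ (begin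
      α i * β r + ᾱ i * β i ≈⟨ +-cong (*-congʳ αᵢ) (*-congʳ ᾱᵢ) ⟩
      1# * β r + 0# * β i   ≈⟨ +-cong (*-identityˡ _) (zeroˡ _) ⟩
      β r + 0#              ≈⟨ +-identityʳ _ ⟩
      β r                   ∎)

    -- `lhs` and `rhs` are the two sides of the recurrence summed over a fibre, with `e p` for
    -- `ε p i`. Their first lines belong to `g`, the outer sums over `r` to `g` with parent `r` at
    -- `i`.
    lhs rhs normal : Carrier
    lhs = (u₁ * (β i * w) + ∑ (λ p → e p * (u₀ * (β i * w))))
        + ∑ (λ r → u₀ * (moved r i * (e r * w)) + ∑ (λ p → e p * (u₂ * (moved r i * (e r * w)))))
    rhs = (δ * (u₁ * (1# * w)) + ∑ (λ p → e p * (u₀ * (β p * w))))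
        + ∑ (λ r → δ * (u₀ * (ᾱ r * (e r * w))) + ∑ (λ p → e p * (u₂ * (moved r p * (e r * w)))))
    normal = (u₁ * δ) * w + (u₀ * w) * (δ * (Eα + Eᾱ) + Eᾱβ) + (u₂ * w) * ((Eα + Eᾱ) * Eᾱβ)

    lhs-normal : lhs ≈ normal
    lhs-normal = begin
      lhs
        ≈⟨ +-cong (+-cong (*-congˡ (*-congʳ βᵢ)) first) (trans (∑-+ _ _) (+-cong second third)) ⟩
      (u₁ * (δ * w) + (u₀ * (δ * w)) * (Eα + Eᾱ)) + ((u₀ * w) * Eᾱβ + (u₂ * w * (Eα + Eᾱ)) * Eᾱβ)
        ≈⟨ solve 7 (λ u₀ u₁ u₂ w δ E B →
             (u₁ :* (δ :* w) :+ (u₀ :* (δ :* w)) :* E) :+ ((u₀ :* w) :* B :+ (u₂ :* w :* E) :* B) :=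
             (u₁ :* δ) :* w :+ (u₀ :* w) :* (δ :* E :+ B) :+ (u₂ :* w) :* (E :* B))
             refl u₀ u₁ u₂ w δ (Eα + Eᾱ) Eᾱβ ⟩
      normal ∎
      where
      first : ∑ (λ p → e p * (u₀ * (β i * w))) ≈ (u₀ * (δ * w)) * (Eα + Eᾱ)
      first = trans (∑-pull _ λ p → trans (*-comm _ _) (*-congʳ (*-congˡ (*-congʳ βᵢ)))) (*-congˡ e-split)
      term : ∀ c r → c * (moved r i * (e r * w)) ≈ (c * w) * (e r * (ᾱ r * β r))
      term c r = trans (*-congˡ (*-congʳ (movedᵢ r)))
        (solve 4 (λ c m e w → c :* (m :* (e :* w)) := (c :* w) :* (e :* m)) refl c (ᾱ r * β r) (e r) w)
      second : ∑ (λ r → u₀ * (moved r i * (e r * w))) ≈ (u₀ * w) * Eᾱβ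
      second = ∑-pull _ (term u₀)
      third : ∑ (λ r → ∑ (λ p → e p * (u₂ * (moved r i * (e r * w))))) ≈ (u₂ * w * (Eα + Eᾱ)) * Eᾱβ
      third = ∑-pull _ λ r → begin
        ∑ (λ p → e p * (u₂ * (moved r i * (e r * w))))
          ≈⟨ ∑-pull _ (λ p → trans (*-comm _ _) (*-congʳ (term u₂ r))) ⟩
        (u₂ * w * (e r * (ᾱ r * β r))) * ∑ e
          ≈⟨ *-congˡ e-split ⟩
        (u₂ * w * (e r * (ᾱ r * β r))) * (Eα + Eᾱ)
          ≈⟨ solve 3 (λ a b c → (a :* b) :* c := (a :* c) :* b) refl (u₂ * w) (e r * (ᾱ r * β r)) (Eα + Eᾱ) ⟩
        (u₂ * w * (Eα + Eᾱ)) * (e r * (ᾱ r * β r)) ∎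

    -- In the terms with `e p * e r`, a `p` descending from `i` gets the root of `r`, as `i` does,
    -- which agrees with the left side directly. If neither `p` nor `r` descends from `i`, the term
    -- agrees with the left one in which they are exchanged.
    rhs-normal : rhs ≈ normal
    rhs-normal = begin
      rhs
        ≈⟨ +-cong (+-cong (*-congˡ (*-congˡ (*-identityˡ w))) first) (trans (∑-+ _ _) (+-cong second third)) ⟩
      (δ * (u₁ * w) + (u₀ * w) * (δ * Eα + Eᾱβ))
        + ((δ * (u₀ * w)) * Eᾱ + ((u₂ * w * Eα) * Eᾱβ + (u₂ * w * Eᾱβ) * Eᾱ))
        ≈⟨ solve 8 (λ u₀ u₁ u₂ w δ A C B →
             (δ :* (u₁ :* w) :+ (u₀ :* w) :* (δ :* A :+ B))
               :+ ((δ :* (u₀ :* w)) :* C :+ ((u₂ :* w :* A) :* B :+ (u₂ :* w :* B) :* C)) :=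
             (u₁ :* δ) :* w :+ (u₀ :* w) :* (δ :* (A :+ C) :+ B) :+ (u₂ :* w) :* ((A :+ C) :* B))
             refl u₀ u₁ u₂ w δ Eα Eᾱ Eᾱβ ⟩
      normal ∎
      where
      first : ∑ (λ p → e p * (u₀ * (β p * w))) ≈ (u₀ * w) * (δ * Eα + Eᾱβ)
      first = trans
        (∑-pull _ λ p → solve 4 (λ e u b w → e :* (u :* (b :* w)) := (u :* w) :* (e :* b)) refl (e p) u₀ (β p) w)
        (*-congˡ eβ-split)
      second : ∑ (λ r → δ * (u₀ * (ᾱ r * (e r * w)))) ≈ (δ * (u₀ * w)) * Eᾱ
      second = ∑-pull _ λ r →
        solve 5 (λ δ u a e w → δ :* (u :* (a :* (e :* w))) := (δ :* (u :* w)) :* (e :* a)) refl δ u₀ (ᾱ r) (e r) w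
      inner : ∀ r → ∑ (λ p → e p * (u₂ * (moved r p * (e r * w))))
                  ≈ (u₂ * w * Eα) * (e r * (ᾱ r * β r)) + (u₂ * w * Eᾱβ) * (e r * ᾱ r)
      inner r = begin
        ∑ (λ p → e p * (u₂ * (moved r p * (e r * w))))
          ≈⟨ ∑-cong (λ p →
               solve 8 (λ eₚ u aᵣ aₚ bᵣ c eᵣ w →
                 eₚ :* (u :* ((aᵣ :* (aₚ :* bᵣ :+ c)) :* (eᵣ :* w))) :=
                 (u :* w :* (eᵣ :* (aᵣ :* bᵣ))) :* (eₚ :* aₚ) :+ (u :* w :* (eᵣ :* aᵣ)) :* (eₚ :* c))
                 refl (e p) u₂ (ᾱ r) (α p) (β r) (ᾱ p * β p) (e r) w) ⟩
        ∑ (λ p → (u₂ * w * (e r * (ᾱ r * β r))) * (e p * α p) + (u₂ * w * (e r * ᾱ r)) * (e p * (ᾱ p * β p)))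
          ≈⟨ trans (∑-+ _ _) (+-cong (∑-*ˡ _ _) (∑-*ˡ _ _)) ⟩
        (u₂ * w * (e r * (ᾱ r * β r))) * Eα + (u₂ * w * (e r * ᾱ r)) * Eᾱβ
          ≈⟨ solve 5 (λ c x y A B → (c :* x) :* A :+ (c :* y) :* B := (c :* A) :* x :+ (c :* B) :* y)
               refl (u₂ * w) (e r * (ᾱ r * β r)) (e r * ᾱ r) Eα Eᾱβ ⟩
        (u₂ * w * Eα) * (e r * (ᾱ r * β r)) + (u₂ * w * Eᾱβ) * (e r * ᾱ r) ∎
      third : ∑ (λ r → ∑ (λ p → e p * (u₂ * (moved r p * (e r * w)))))
            ≈ (u₂ * w * Eα) * Eᾱβ + (u₂ * w * Eᾱβ) * Eᾱ
      third = trans (∑-cong inner)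
        (trans (∑-+ _ _) (+-cong (∑-*ˡ _ _) (∑-*ˡ _ _)))

    lhs≈rhs : lhs ≈ rhs
    lhs≈rhs = trans lhs-normal (sym rhs-normal)

  forestTerm≈0 : ∀ k f → (count f ≡ k → Forest f → parentWeight f ≈ 0#) → forestTerm k f ≈ 0#
  forestTerm≈0 k f w≈0 = ⟦⟧*≈0 (count f ℕ.≟ k) λ e → ⟦⟧*≈0 (forest? f) λ F → w≈0 e F

  rootedTerm≈0 : ∀ k p r f → (count f ≡ k → Forest f → parentWeight f ≈ 0#) → rootedTerm k p r f ≈ 0#
  rootedTerm≈0 k p r f w≈0 =
    ⟦⟧*≈0 (count f ℕ.≟ k) λ e → ⟦⟧*≈0 (rootedForest? f p r) λ (F , _) → w≈0 e F

  module Attachment (g : Parents n) (i : Fin n) (orphan : lookup g i ≡ nothing) where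

    attach : Fin n → Parents n
    attach r = g [ i ]≔ just r

    attach-count : ∀ r k → ⟦ count (attach r) ℕ.≟ k ⟧ ≡ ⟦ suc (count g) ℕ.≟ k ⟧
    attach-count r k = cong (λ c → ⟦ c ℕ.≟ k ⟧) (count-update g i orphan r)

    attach-weight : ∀ r → parentWeight (attach r) ≈ ε r i * parentWeight g
    attach-weight r = ∏.sum-update arcFactor g i (just r) (reflexive (cong (λ x → arcFactor x i) orphan))

    module _ (F : Forest g) (j : Fin n) where

      root : Fin n → Fin n
      root p = proj₁ (F p)

      root-≡ : ∀ {p r} → Root g p r → root p ≡ r
      root-≡ ρ = root-unique (proj₂ (F _)) ρ

      α ᾱ β : Fin n → Carrier
      α p = ⟦ root p ≟ i ⟧
      ᾱ p = ⟦ ¬? (root p ≟ i) ⟧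
      β p = ⟦ root p ≟ j ⟧

      α+ᾱ : ∀ p → α p + ᾱ p ≈ 1#
      α+ᾱ p with does (root p ≟ i)
      ... | true  = +-identityʳ 1#
      ... | false = +-identityˡ 1#

      αβ : ∀ p → α p * β p ≈ ⟦ i ≟ j ⟧ * α p
      αβ p with root p ≟ i
      ... | yes ≡.refl = *-comm _ _
      ... | no  _      = trans (zeroˡ _) (sym (zeroʳ _))

      rootᵢ : root i ≡ i
      rootᵢ = root-≡ (stop orphan)

      αᵢ : α i ≈ 1#
      αᵢ = reflexive (⟦⟧-true (root i ≟ i) rootᵢ)

      ᾱᵢ : ᾱ i ≈ 0#
      ᾱᵢ = reflexive (⟦⟧-false (¬? (root i ≟ i)) λ ne → ne rootᵢ)

      βᵢ : β i ≈ ⟦ i ≟ j ⟧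
      βᵢ = reflexive (cong (λ r → ⟦ r ≟ j ⟧) rootᵢ)

      rooted-base : ∀ p → ⟦ rootedForest? g p j ⟧ ≡ β p
      rooted-base p = ⟦⟧-⇔ (rootedForest? g p j) (root p ≟ j)
        (λ (_ , ρ) → root-≡ ρ) (λ where ≡.refl → F , proj₂ (F p))

      forest-attach : ∀ r → ⟦ forest? (attach r) ⟧ ≡ ᾱ r
      forest-attach r = ⟦⟧-⇔ (forest? (attach r)) (¬? (root r ≟ i)) to
        (λ r≢i → forest-extend g i orphan r F (r≢i ∘ root-≡))
        where
        to : Forest (attach r) → root r ≢ i
        to F′ e = root-lost g i orphan r ρ ρ (proj₂ (F′ r))
          where ρ = subst (Root g r) e (proj₂ (F r))

      rooted-attach : ∀ r p → ⟦ rootedForest? (attach r) p j ⟧ ≈ ᾱ r * (α p * β r + ᾱ p * β p)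
      rooted-attach r p with root r ≟ i
      ... | yes e = trans
        (reflexive (⟦⟧-false (rootedForest? (attach r) p j)
          λ (F′ , _) → root-lost g i orphan r ρ ρ (proj₂ (F′ r))))
        (sym (zeroˡ _))
        where ρ = subst (Root g r) e (proj₂ (F r))
      ... | no r≢i = trans (kept (root p ≟ i)) (sym (*-identityˡ _))
        where
        F′ = forest-extend g i orphan r F (r≢i ∘ root-≡)
        σ : Root (attach r) r (root r)
        σ = root-kept g i orphan r r≢i (proj₂ (F r))
        kept : (d : Dec (root p ≡ i)) →
               ⟦ rootedForest? (attach r) p j ⟧ ≈ ⟦ d ⟧ * β r + ⟦ ¬? d ⟧ * β p
        kept (yes e) = trans
          (reflexive (⟦⟧-⇔ (rootedForest? (attach r) p j) (root r ≟ j)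
            (λ (_ , ρ′) → root-unique ρ ρ′) (λ where ≡.refl → F′ , ρ)))
          (sym (trans (+-cong (*-identityˡ _) (zeroˡ _)) (+-identityʳ _)))
          where ρ = root-moved g i orphan r (subst (Root g p) e (proj₂ (F p))) σ
        kept (no p≢i) = trans
          (reflexive (⟦⟧-⇔ (rootedForest? (attach r) p j) (root p ≟ j)
            (λ (_ , ρ′) → root-unique ρ ρ′) (λ where ≡.refl → F′ , ρ)))
          (sym (trans (+-cong (zeroˡ _) (*-identityˡ _)) (+-identityˡ _)))
          where ρ = root-kept g i orphan r p≢i (proj₂ (F p))

      rootedTerm-base : ∀ k p → rootedTerm k p j g ≈ ⟦ count g ℕ.≟ k ⟧ * (β p * parentWeight g)
      rootedTerm-base k p = *-congˡ (*-congʳ (reflexive (rooted-base p)))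

      forestTerm-base : ∀ k → forestTerm k g ≈ ⟦ count g ℕ.≟ k ⟧ * (1# * parentWeight g)
      forestTerm-base k = *-congˡ (*-congʳ (reflexive (⟦⟧-true (forest? g) F)))

      rootedTerm-attach : ∀ k r p → rootedTerm k p j (attach r) ≈
        ⟦ suc (count g) ℕ.≟ k ⟧ * ((ᾱ r * (α p * β r + ᾱ p * β p)) * (ε r i * parentWeight g))
      rootedTerm-attach k r p =
        *-cong (reflexive (attach-count r k)) (*-cong (rooted-attach r p) (attach-weight r))

      forestTerm-attach : ∀ k r → forestTerm k (attach r) ≈
        ⟦ suc (count g) ℕ.≟ k ⟧ * (ᾱ r * (ε r i * parentWeight g))
      forestTerm-attach k r =
        *-cong (reflexive (attach-count r k)) (*-cong (reflexive (forest-attach r)) (attach-weight r))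

  module _ (k : ℕ) (i j : Fin n) where

    private
      φ ψ : Parents n → Carrier
      φ f = rootedTerm (suc k) i j f + ∑ (λ p → ε p i * rootedTerm k i j f)
      ψ f = ⟦ i ≟ j ⟧ * forestTerm (suc k) f + ∑ (λ p → ε p i * rootedTerm k p j f)

      zero-φ : ∀ {f} → ¬ Forest f → φ f ≈ 0#
      zero-φ {f} ¬F = trans (+-cong (rootedTerm≈0 _ _ _ f λ _ F → contradiction F ¬F)
        (∑-zero λ p → trans (*-congˡ (rootedTerm≈0 _ _ _ f λ _ F → contradiction F ¬F)) (zeroʳ _))) (+-identityˡ 0#)

      zero-ψ : ∀ {f} → ¬ Forest f → ψ f ≈ 0#
      zero-ψ {f} ¬F = trans (+-cong (trans (*-congˡ (forestTerm≈0 _ f λ _ F → contradiction F ¬F)) (zeroʳ _))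
        (∑-zero λ p → trans (*-congˡ (rootedTerm≈0 _ _ _ f λ _ F → contradiction F ¬F)) (zeroʳ _))) (+-identityˡ 0#)

      -- Cutting the arc into `i` preserves forests, so a fibre whose `g` is not a forest contains
      -- none.
      fibre-zero : ∀ {χ} → (∀ {f} → ¬ Forest f → χ f ≈ 0#) → ∀ g → lookup g i ≡ nothing →
                   ¬ Forest g → fibre χ i g ≈ 0#
      fibre-zero zero-χ g orphan ¬F = trans
        (+-cong (zero-χ ¬F) (∑-zero λ r → zero-χ (¬F ∘ forest-restrict g i orphan r))) (+-identityˡ 0#)

      φ≈ψ : ∀ g → lookup g i ≡ nothing → Dec (Forest g) → fibre φ i g ≈ fibre ψ i g
      φ≈ψ g orphan (no ¬F) =
        trans (fibre-zero zero-φ g orphan ¬F) (sym (fibre-zero zero-ψ g orphan ¬F))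
      φ≈ψ g orphan (yes F) = begin
        fibre φ i g
          ≈⟨ +-cong
               (+-cong (rootedTerm-base F j (suc k) i) (∑-cong λ p → *-congˡ (rootedTerm-base F j k i)))
               (∑-cong λ r → +-cong (rootedTerm-attach F j (suc k) r i)
                                    (∑-cong λ p → *-congˡ (rootedTerm-attach F j k r i))) ⟩
        lhs
          ≈⟨ lhs≈rhs ⟩
        rhs
          ≈⟨ +-cong
               (+-cong (*-congˡ (forestTerm-base F j (suc k))) (∑-cong λ p → *-congˡ (rootedTerm-base F j k p)))
               (∑-cong λ r → +-cong (*-congˡ (forestTerm-attach F j (suc k) r))
                                    (∑-cong λ p → *-congˡ (rootedTerm-attach F j k r p))) ⟨
        fibre ψ i g ∎
        where
        open Attachment g i orphan
        -- An attached forest has one more arc than `g`, and `suc (count g) ℕ.≟ suc k` has the same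
        -- truth value as `count g ℕ.≟ k`; so `u₀` serves both `g` at size `k` and its extensions at
        -- size `suc k`.
        open FibreIdentity i {⟦ count g ℕ.≟ k ⟧} {⟦ count g ℕ.≟ suc k ⟧} {⟦ suc (count g) ℕ.≟ k ⟧}
          {parentWeight g} {e = λ p → ε p i}
          (α+ᾱ F j) (αβ F j) (αᵢ F j) (ᾱᵢ F j) (βᵢ F j)

    -- Row `i` of the recurrence with the off-diagonal part of `L` moved to the right, which frees
    -- it of subtraction and makes it meaningful in a semiring.
    rootedSum-suc : rootedSum (suc k) i j + ∑ (λ p → ε p i * rootedSum k i j)
                  ≈ ⟦ i ≟ j ⟧ * forestSum (suc k) + ∑ (λ p → ε p i * rootedSum k p j)
    rootedSum-suc = begin
      rootedSum (suc k) i j + ∑ (λ p → ε p i * rootedSum k i j)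
        ≈⟨ +-congˡ (linear (λ _ → i)) ⟨
      rootedSum (suc k) i j + sumᵛ n (λ f → ∑ (λ p → ε p i * rootedTerm k i j f))
        ≈⟨ sumᵛ-+ n _ _ ⟨
      sumᵛ n φ
        ≈⟨ sumᵛ-fibre φ ψ i (λ g orphan → φ≈ψ g orphan (forest? g)) ⟩
      sumᵛ n ψ
        ≈⟨ sumᵛ-+ n _ _ ⟩
      sumᵛ n (λ f → ⟦ i ≟ j ⟧ * forestTerm (suc k) f) + sumᵛ n (λ f → ∑ (λ p → ε p i * rootedTerm k p j f))
        ≈⟨ +-cong (sumᵛ-*ˡ n _ _) (linear (λ p → p)) ⟩
      ⟦ i ≟ j ⟧ * forestSum (suc k) + ∑ (λ p → ε p i * rootedSum k p j) ∎
      where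
      linear : ∀ (x : Fin n → Fin n) →
        sumᵛ n (λ f → ∑ (λ p → ε p i * rootedTerm k (x p) j f)) ≈ ∑ (λ p → ε p i * rootedSum k (x p) j)
      linear x = trans (sumᵛ-sum n _) (∑-cong λ p → sumᵛ-*ˡ n (ε p i) (rootedTerm k (x p) j))

  -- Giving `i` a parent creates an arc, so only `g` itself survives in each fibre, and there `i` is
  -- its own root.
  rootedSum-zero : ∀ i j → rootedSum 0 i j ≈ ⟦ i ≟ j ⟧ * forestSum 0
  rootedSum-zero i j = trans
    (sumᵛ-fibre _ (λ f → ⟦ i ≟ j ⟧ * forestTerm 0 f) i per-fibre) (sumᵛ-*ˡ n _ _)
    where
    arcless : ∀ {g} (orphan : lookup g i ≡ nothing) r {x} → ⟦ count (g [ i ]≔ just r) ℕ.≟ 0 ⟧ * x ≈ 0#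
    arcless {g} orphan r = trans (*-congʳ (reflexive (Attachment.attach-count g i orphan r 0))) (zeroˡ _)

    base : ∀ g → lookup g i ≡ nothing → Dec (Forest g) → rootedTerm 0 i j g ≈ ⟦ i ≟ j ⟧ * forestTerm 0 g
    base g orphan (no ¬F) = trans (rootedTerm≈0 0 i j g λ _ F → contradiction F ¬F)
      (sym (trans (*-congˡ (forestTerm≈0 0 g λ _ F → contradiction F ¬F)) (zeroʳ _)))
    base g orphan (yes F) = begin
      rootedTerm 0 i j g            ≈⟨ rootedTerm-base F j 0 i ⟩
      u * (β F j i * w)             ≈⟨ *-congˡ (*-congʳ (βᵢ F j)) ⟩
      u * (⟦ i ≟ j ⟧ * w)           ≈⟨ solve 3 (λ u d w → u :* (d :* w) := d :* (u :* w)) refl u ⟦ i ≟ j ⟧ w ⟩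
      ⟦ i ≟ j ⟧ * (u * w)           ≈⟨ *-congˡ (*-congˡ (*-identityˡ w)) ⟨
      ⟦ i ≟ j ⟧ * (u * (1# * w))    ≈⟨ *-congˡ (forestTerm-base F j 0) ⟨
      ⟦ i ≟ j ⟧ * forestTerm 0 g    ∎
      where
      open Attachment g i orphan
      u = ⟦ count g ℕ.≟ 0 ⟧
      w = parentWeight g

    per-fibre : ∀ g → lookup g i ≡ nothing →
      fibre (rootedTerm 0 i j) i g ≈ fibre (λ f → ⟦ i ≟ j ⟧ * forestTerm 0 f) i g
    per-fibre g orphan = +-cong (base g orphan (forest? g)) (∑-cong λ r →
      trans (arcless {g} orphan r) (sym (trans (*-congˡ (arcless {g} orphan r)) (zeroʳ _))))

-- Positivity in an ordered field

module OrderedFieldProperties {c ℓ₁ ℓ₂ ℓ₃} (K : OrderedField c ℓ₁ ℓ₂ ℓ₃) where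

  open OrderedField K
  open MonoidSum +-monoid using (sum)
  open Exp semiring using (_^_)
  open IsStrictPartialOrder isStrictPartialOrder using (<-respʳ-≈; <-respˡ-≈) renaming (trans to <-trans)
  open RingProperties (CommutativeRing.ring commutativeRing) using (-1*x≈-x; -‿involutive)

  -- Being invertible, 1 is apart from 0; and if it were negative, it would still be positive as the
  -- square of `- 1#`.
  0<1 : 0# < 1#
  0<1 with Equivalence.to #⇔<⊎> 1#0
    where
    1#0 : 1# # 0#
    1#0 = invertible⇒# (1# , trans (*-congˡ (x-0≈x 1#)) (*-identityˡ 1#)
                           , trans (*-congʳ (x-0≈x 1#)) (*-identityˡ 1#))
  ... | inj₂ 0<1 = 0<1
  ... | inj₁ 1<0 = <-respʳ-≈ (trans (-1*x≈-x (- 1#)) (-‿involutive 1#)) (*-pos 0<-1 0<-1)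
    where
    0<-1 : 0# < - 1#
    0<-1 = <-respˡ-≈ (-‿inverseʳ 1#) (<-respʳ-≈ (+-identityˡ _) (+-monoˡ-< (- 1#) 1<0))

  -- A disjunction, although the order is not assumed decidable: for `σ` it is settled by whether
  -- the list of forests is empty.
  NonNegative : Carrier → Set _
  NonNegative x = x ≈ 0# ⊎ 0# < x

  pos+nonNeg : ∀ {x y} → 0# < x → NonNegative y → 0# < x + y
  pos+nonNeg 0<x (inj₁ y≈0) = <-respʳ-≈ (sym (trans (+-congˡ y≈0) (+-identityʳ _))) 0<x
  pos+nonNeg 0<x (inj₂ 0<y) = <-trans 0<y (<-respˡ-≈ (+-identityˡ _) (+-monoˡ-< _ 0<x))

  nonNeg+nonNeg : ∀ {x y} → NonNegative x → NonNegative y → NonNegative (x + y)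
  nonNeg+nonNeg (inj₁ x≈0) (inj₁ y≈0) = inj₁ (trans (+-cong x≈0 y≈0) (+-identityˡ 0#))
  nonNeg+nonNeg (inj₁ x≈0) (inj₂ 0<y) = inj₂ (<-respʳ-≈ (sym (trans (+-congʳ x≈0) (+-identityˡ _))) 0<y)
  nonNeg+nonNeg (inj₂ 0<x) ny         = inj₂ (pos+nonNeg 0<x ny)

  pos*nonNeg : ∀ {x y} → 0# < x → NonNegative y → NonNegative (x * y)
  pos*nonNeg 0<x (inj₁ y≈0) = inj₁ (trans (*-congˡ y≈0) (zeroʳ _))
  pos*nonNeg 0<x (inj₂ 0<y) = inj₂ (*-pos 0<x 0<y)

  ^-pos : ∀ {x} → 0# < x → ∀ k → 0# < x ^ k
  ^-pos 0<x zero    = 0<1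
  ^-pos 0<x (suc k) = *-pos 0<x (^-pos 0<x k)

  sum-nonNeg : ∀ {m} {t : Fin m → Carrier} → (∀ i → NonNegative (t i)) → NonNegative (sum t)
  sum-nonNeg {zero}  nn = inj₁ refl
  sum-nonNeg {suc m} nn = nonNeg+nonNeg (nn Fin.zero) (sum-nonNeg (nn ∘ Fin.suc))

  module _ {a} {A : Set a} {h : A → Carrier} where

    product-pos : ∀ {xs} → (∀ {x} → x ∈ₗ xs → 0# < h x) → 0# < foldr _*_ 1# (map h xs)
    product-pos {[]}     pos = 0<1
    product-pos {x ∷ xs} pos = *-pos (pos (here ≡.refl)) (product-pos (pos ∘ there))

    total-nonNeg : ∀ {xs} → (∀ {x} → x ∈ₗ xs → 0# < h x) → NonNegative (foldr _+_ 0# (map h xs))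
    total-nonNeg {[]}     pos = inj₁ refl
    total-nonNeg {x ∷ xs} pos = nonNeg+nonNeg (inj₂ (pos (here ≡.refl))) (total-nonNeg (pos ∘ there))

    total-pos : ∀ {xs y} → (∀ {x} → x ∈ₗ xs → 0# < h x) → y ∈ₗ xs → 0# < foldr _+_ 0# (map h xs)
    total-pos {x ∷ xs} pos _ = pos+nonNeg (pos (here ≡.refl)) (total-nonNeg (pos ∘ there))

-- Weights of the out forests of a weighted digraph

module ForestWeights {c ℓ₁ ℓ₂ ℓ₃} (K : OrderedField c ℓ₁ ℓ₂ ℓ₃) {n}
  (Γ : WeightedDigraphs.WeightedDigraph K n) where

  open OrderedField K
  open WeightedDigraphs K
  open WeightedDigraph Γ
  open OrderedFieldProperties K
  open Exp semiring using (_^_)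
  open ForestSums (CommutativeRing.commutativeSemiring commutativeRing) ε public
  open import Relation.Binary.Reasoning.Setoid (CommutativeRing.setoid commutativeRing) hiding (stop)
  private
    module ∏ = CommutativeMonoidFolds (CommutativeRing.*-commutativeMonoid commutativeRing)
    module Σ = CommutativeMonoidFolds (CommutativeRing.+-commutativeMonoid commutativeRing)

  weight-toDigraph : ∀ f → weight Γ (toDigraph f) ≈ parentWeight f
  weight-toDigraph f = ∏.fold-arcs (λ (i , j) → ε i j) f

  product≈0⊎all : ∀ {q m} {t : Fin m → Carrier} {Q : Fin m → Set q} →
                  (∀ j → t j ≈ 0# ⊎ Q j) → ∏.sum t ≈ 0# ⊎ (∀ j → Q j)
  product≈0⊎all {m = zero}  d = inj₂ λ ()
  product≈0⊎all {m = suc m} d with d Fin.zero | product≈0⊎all (d ∘ Fin.suc)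
  ... | inj₁ t≈0 | _        = inj₁ (trans (*-congʳ t≈0) (zeroˡ _))
  ... | inj₂ _   | inj₁ p≈0 = inj₁ (trans (*-congˡ p≈0) (zeroʳ _))
  ... | inj₂ q   | inj₂ qs  = inj₂ λ where
    Fin.zero    → q
    (Fin.suc j) → qs j

  -- The alternative is decided on the arcs of the digraph, not by testing field elements for zero:
  -- a single non-arc supplies a zero factor.
  weight≈0⊎spanning : ∀ f → parentWeight f ≈ 0# ⊎ SpanningSubgraph (toDigraph f) digraph
  weight≈0⊎spanning f with product≈0⊎all {Q = λ j → ∀ i → lookup f j ≡ just i → Arc digraph i j} factor
    where
    factor : ∀ j → arcFactor (lookup f j) j ≈ 0# ⊎ (∀ i → lookup f j ≡ just i → Arc digraph i j)
    factor j with lookup f j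
    ... | nothing = inj₂ λ _ ()
    ... | just p with arc? digraph p j
    ...   | yes a = inj₂ λ where _ ≡.refl → a
    ...   | no ¬a = inj₁ (¬arc⇒zero ¬a)
  ... | inj₁ w≈0 = inj₁ w≈0
  ... | inj₂ sub = inj₂ λ i {j} a → sub j i (arc⇒parent {f = f} a)

  forestTerm≈ : ∀ k f (d : Dec (IsOutForest digraph (toDigraph f) × numArcs (toDigraph f) ≡ k)) →
    (if does d then weight Γ (toDigraph f) else 0#) ≈ forestTerm k f
  forestTerm≈ k f (yes ((_ , F) , e)) = sym (trans
    (*-cong (reflexive (⟦⟧-true (count f ℕ.≟ k) (≡.trans (≡.sym (numArcs-toDigraph f)) e)))
            (*-cong (reflexive (⟦⟧-true (forest? f) (acyclic⇒forest (IsDivergingForest.acyclic F))))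
                    (sym (weight-toDigraph f))))
    (trans (*-identityˡ _) (*-identityˡ _)))
  forestTerm≈ k f (no ¬p) = sym (forestTerm≈0 k f vanish)
    where
    vanish : count f ≡ k → Forest f → parentWeight f ≈ 0#
    vanish e F with weight≈0⊎spanning f
    ... | inj₁ w≈0 = w≈0
    ... | inj₂ sub = contradiction
      ((sub , toDigraph-isDivergingForest F) , ≡.trans (numArcs-toDigraph f) e) ¬p

  σ≈forestSum : ∀ k → σ Γ k ≈ forestSum k
  σ≈forestSum k = begin
    σ Γ k
      ≈⟨ Σ.fold-↭ (weight Γ) (outForests-↭ digraph k) ⟩
    Σ.fold (weight Γ) (map toDigraph (filter P? (parents n)))
      ≡⟨ Σ.fold-map (weight Γ) toDigraph (filter P? (parents n)) ⟩
    Σ.fold (weight Γ ∘ toDigraph) (filter P? (parents n))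
      ≈⟨ Σ.fold-filter P? (weight Γ ∘ toDigraph) (parents n) ⟩
    Σ.fold (λ f → if does (P? f) then weight Γ (toDigraph f) else 0#) (parents n)
      ≈⟨ Σ.fold-cong (λ f → forestTerm≈ k f (P? f)) (parents n) ⟩
    Σ.fold (forestTerm k) (parents n)
      ≈⟨ sumᵛ-vectors n (forestTerm k) ⟩
    forestSum k ∎
    where
    P? = isOutForestWithArcs? digraph k ∘ toDigraph

  weight-pos : ∀ {F} → SpanningSubgraph F digraph → 0# < weight Γ F
  weight-pos {F} sub = product-pos {xs = arcs F} λ {(i , j)} e∈ →
    arc⇒positive (sub i (proj₂ (∈-filter⁻ (λ (i , j) → arc? F i j) {xs = cartesianProduct (allFin n) (allFin n)} e∈)))

  outForests-pos : ∀ {k F} → F ∈ₗ outForests digraph k → 0# < weight Γ F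
  outForests-pos {k} {F} F∈ =
    weight-pos {F} (proj₁ (proj₁ (proj₂ (∈-filter⁻ (isOutForestWithArcs? digraph k) {xs = digraphs n} F∈))))

  arcless : Parents n
  arcless = replicate n nothing

  arcless-outForest : toDigraph arcless ∈ₗ outForests digraph 0
  arcless-outForest = ∈-filter⁺ (isOutForestWithArcs? digraph 0) (∈-digraphs _)
    ( ( (λ i {j} a → contradiction (arc⇒parent {f = arcless} a) (nothing≢just {f = arcless} (orphan j)))
      , toDigraph-isDivergingForest {f = arcless} λ p → p , stop (orphan p))
    , ≡.trans (numArcs-toDigraph arcless) count-arcless)
    where
    orphan : ∀ p → lookup arcless p ≡ nothing
    orphan p = lookup-replicate p nothing
    count-arcless : count arcless ≡ 0
    count-arcless = ℕ-Folds.sum-zero λ j → cong (maybe (const 1) 0) (orphan j)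

  σ-nonNeg : ∀ k → NonNegative (σ Γ k)
  σ-nonNeg k = total-nonNeg {xs = outForests digraph k} outForests-pos

  σ₀-pos : 0# < σ Γ 0
  σ₀-pos = total-pos {xs = outForests digraph 0} outForests-pos arcless-outForest

  -- The summand of index 0 is positive because of the arcless forest, and the others are
  -- nonnegative.
  s-pos : ∀ k {τ} → 0# < τ → 0# < s Γ k τ
  s-pos k {τ} 0<τ = pos+nonNeg
    (*-pos (^-pos 0<τ 0) σ₀-pos)
    (sum-nonNeg {t = λ (j : Fin k) → τ ^ suc (toℕ j) * σ Γ (suc (toℕ j))}
      λ j → pos*nonNeg (^-pos 0<τ (suc (toℕ j))) (σ-nonNeg (suc (toℕ j))))

  module _ {v} (dim : IsOutForestDimension digraph v) where

    private
      m = n ∸ v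

      oversized : ∀ f → count f ≡ suc m → Forest f → parentWeight f ≈ 0#
      oversized f e F with weight≈0⊎spanning f
      ... | inj₁ w≈0 = w≈0
      ... | inj₂ sub = contradiction
        (ℕ.≤-trans (ℕ.+-monoˡ-≤ v (ℕ.≤-reflexive (≡.sym e))) (outForest-size dim F sub))
        -- With `suc m` arcs the size bound reads `suc m + v ≤ n`, against `n ≤ v + m`, which
        -- truncated subtraction always satisfies.
        (ℕ.<⇒≱ (ℕ.s≤s (ℕ.≤-trans (ℕ.m≤n+m∸n n v) (ℕ.≤-reflexive (ℕ.+-comm v m)))))

    forestSum-oversized : forestSum (suc m) ≈ 0#
    forestSum-oversized = sumᵛ-zero n λ f → forestTerm≈0 (suc m) f (oversized f)

    rootedSum-oversized : ∀ i j → rootedSum (suc m) i j ≈ 0#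
    rootedSum-oversized i j = sumᵛ-zero n λ f → rootedTerm≈0 (suc m) i j f (oversized f)

-- Matrix algebra

module MatrixProperties {c ℓ₁ ℓ₂ ℓ₃} (K : OrderedField c ℓ₁ ℓ₂ ℓ₃) where

  open OrderedField K
  open Matrices K
  open Summation (CommutativeRing.commutativeSemiring commutativeRing)
  open SemiringSolver (CommutativeRing.commutativeSemiring commutativeRing) using (solve; _:+_; _:*_; _:=_)
  open import Relation.Binary.Reasoning.Setoid (CommutativeRing.setoid commutativeRing)

  module _ {n : ℕ} where

    *ᴹ-∑ : ∀ (A B : Matrix n) i j → (A *ᴹ B) i j ≈ ∑ (λ k → A i k * B k j)
    *ᴹ-∑ A B i j = reflexive (≡.sym (∑≡sum (λ k → A i k * B k j)))

    *ᴹ-cong : ∀ {A A′ B B′ : Matrix n} → A ≈ᴹ A′ → B ≈ᴹ B′ → A *ᴹ B ≈ᴹ A′ *ᴹ B′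
    *ᴹ-cong {A} {A′} {B} {B′} a b i j = begin
      (A *ᴹ B) i j                ≈⟨ *ᴹ-∑ A B i j ⟩
      ∑ (λ k → A i k * B k j)     ≈⟨ ∑-cong (λ k → *-cong (a i k) (b k j)) ⟩
      ∑ (λ k → A′ i k * B′ k j)   ≈⟨ *ᴹ-∑ A′ B′ i j ⟨
      (A′ *ᴹ B′) i j              ∎

    *ᴹ-congˡ : ∀ (A : Matrix n) {B B′} → B ≈ᴹ B′ → A *ᴹ B ≈ᴹ A *ᴹ B′
    *ᴹ-congˡ A = *ᴹ-cong {A} {A} λ i j → refl

    *ᴹ-congʳ : ∀ {A A′} (B : Matrix n) → A ≈ᴹ A′ → A *ᴹ B ≈ᴹ A′ *ᴹ B
    *ᴹ-congʳ {A} {A′} B a = *ᴹ-cong {A} {A′} {B} a λ i j → refl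

    *ᴹ-distribˡ : ∀ A B C → A *ᴹ (B +ᴹ C) ≈ᴹ A *ᴹ B +ᴹ A *ᴹ C
    *ᴹ-distribˡ A B C i j = begin
      (A *ᴹ (B +ᴹ C)) i j                               ≈⟨ *ᴹ-∑ A (B +ᴹ C) i j ⟩
      ∑ (λ k → A i k * (B k j + C k j))                 ≈⟨ ∑-cong (λ k → distribˡ _ _ _) ⟩
      ∑ (λ k → A i k * B k j + A i k * C k j)           ≈⟨ ∑-+ _ _ ⟩
      ∑ (λ k → A i k * B k j) + ∑ (λ k → A i k * C k j) ≈⟨ +-cong (*ᴹ-∑ A B i j) (*ᴹ-∑ A C i j) ⟨
      (A *ᴹ B +ᴹ A *ᴹ C) i j                            ∎

    *ᴹ-distribʳ : ∀ A B C → (A +ᴹ B) *ᴹ C ≈ᴹ A *ᴹ C +ᴹ B *ᴹ C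
    *ᴹ-distribʳ A B C i j = begin
      ((A +ᴹ B) *ᴹ C) i j                               ≈⟨ *ᴹ-∑ (A +ᴹ B) C i j ⟩
      ∑ (λ k → (A i k + B i k) * C k j)                 ≈⟨ ∑-cong (λ k → distribʳ _ _ _) ⟩
      ∑ (λ k → A i k * C k j + B i k * C k j)           ≈⟨ ∑-+ _ _ ⟩
      ∑ (λ k → A i k * C k j) + ∑ (λ k → B i k * C k j) ≈⟨ +-cong (*ᴹ-∑ A C i j) (*ᴹ-∑ B C i j) ⟨
      (A *ᴹ C +ᴹ B *ᴹ C) i j                            ∎

    *ᴹ-scaleˡ : ∀ a A B → (a · A) *ᴹ B ≈ᴹ a · (A *ᴹ B)
    *ᴹ-scaleˡ a A B i j = begin
      ((a · A) *ᴹ B) i j              ≈⟨ *ᴹ-∑ (a · A) B i j ⟩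
      ∑ (λ k → a * A i k * B k j)     ≈⟨ ∑-pull a (λ k → *-assoc _ _ _) ⟩
      a * ∑ (λ k → A i k * B k j)     ≈⟨ *-congˡ (*ᴹ-∑ A B i j) ⟨
      (a · (A *ᴹ B)) i j              ∎

    *ᴹ-scaleʳ : ∀ a A B → A *ᴹ (a · B) ≈ᴹ a · (A *ᴹ B)
    *ᴹ-scaleʳ a A B i j = begin
      (A *ᴹ (a · B)) i j
        ≈⟨ *ᴹ-∑ A (a · B) i j ⟩
      ∑ (λ k → A i k * (a * B k j))
        ≈⟨ ∑-pull a (λ k → solve 3 (λ x a y → x :* (a :* y) := a :* (x :* y)) refl (A i k) a (B k j)) ⟩
      a * ∑ (λ k → A i k * B k j)
        ≈⟨ *-congˡ (*ᴹ-∑ A B i j) ⟨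
      (a · (A *ᴹ B)) i j ∎

    *ᴹ-assoc : ∀ (A B C : Matrix n) → (A *ᴹ B) *ᴹ C ≈ᴹ A *ᴹ (B *ᴹ C)
    *ᴹ-assoc A B C i j = begin
      ((A *ᴹ B) *ᴹ C) i j
        ≈⟨ *ᴹ-∑ (A *ᴹ B) C i j ⟩
      ∑ (λ l → (A *ᴹ B) i l * C l j)
        ≈⟨ ∑-cong (λ l → trans (*-comm _ _) (trans (*-congˡ (*ᴹ-∑ A B i l)) (sym (∑-*ˡ _ _)))) ⟩
      ∑ (λ l → ∑ (λ k → C l j * (A i k * B k l)))
        ≈⟨ ∑-comm _ ⟩
      ∑ (λ k → ∑ (λ l → C l j * (A i k * B k l)))
        ≈⟨ ∑-cong (λ k → ∑-pull (A i k) λ l →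
             solve 3 (λ c a b → c :* (a :* b) := a :* (b :* c)) refl (C l j) (A i k) (B k l)) ⟩
      ∑ (λ k → A i k * ∑ (λ l → B k l * C l j))
        ≈⟨ ∑-cong (λ k → *-congˡ (sym (*ᴹ-∑ B C k j))) ⟩
      ∑ (λ k → A i k * (B *ᴹ C) k j)
        ≈⟨ *ᴹ-∑ A (B *ᴹ C) i j ⟨
      (A *ᴹ (B *ᴹ C)) i j ∎

    I-diag : ∀ (i : Fin n) → I i i ≈ 1#
    I-diag i with i ≟ i
    ... | yes _  = refl
    ... | no i≢i = contradiction ≡.refl i≢i

    I-off : ∀ {i j : Fin n} → i ≢ j → I i j ≈ 0#
    I-off {i} {j} i≢j with i ≟ j
    ... | yes i≡j = contradiction i≡j i≢j
    ... | no _    = refl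

    ∑-Iˡ : ∀ i (x : Fin n → Carrier) → ∑ (λ k → I i k * x k) ≈ x i
    ∑-Iˡ i x = trans
      (∑-single i λ k k≢i → trans (*-congʳ (I-off (k≢i ∘ ≡.sym))) (zeroˡ _))
      (trans (*-congʳ (I-diag i)) (*-identityˡ _))

    *ᴹ-identityˡ : ∀ (A : Matrix n) → I *ᴹ A ≈ᴹ A
    *ᴹ-identityˡ A i j = trans (*ᴹ-∑ I A i j) (∑-Iˡ i (λ k → A k j))

    *ᴹ-identityʳ : ∀ (A : Matrix n) → A *ᴹ I ≈ᴹ A
    *ᴹ-identityʳ A i j = trans (*ᴹ-∑ A I i j) (trans
      (∑-single j λ k k≢j → trans (*-congˡ (I-off k≢j)) (zeroʳ _))
      (trans (*-congˡ (I-diag j)) (*-identityʳ _)))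

    sumᴹ-∑ : ∀ {m} (A : Fin m → Matrix n) i j → sumᴹ A i j ≈ ∑ (λ k → A k i j)
    sumᴹ-∑ A i j = reflexive (≡.sym (∑≡sum (λ k → A k i j)))

    *ᴹ-sumᴹ : ∀ {m} A (B : Fin m → Matrix n) → A *ᴹ sumᴹ B ≈ᴹ sumᴹ (λ a → A *ᴹ B a)
    *ᴹ-sumᴹ A B i j = begin
      (A *ᴹ sumᴹ B) i j
        ≈⟨ *ᴹ-∑ A (sumᴹ B) i j ⟩
      ∑ (λ k → A i k * sumᴹ B k j)
        ≈⟨ ∑-cong (λ k → trans (*-congˡ (sumᴹ-∑ B k j)) (sym (∑-*ˡ _ _))) ⟩
      ∑ (λ k → ∑ (λ a → A i k * B a k j))
        ≈⟨ ∑-comm _ ⟩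
      ∑ (λ a → ∑ (λ k → A i k * B a k j))
        ≈⟨ ∑-cong (λ a → sym (*ᴹ-∑ A (B a) i j)) ⟩
      ∑ (λ a → (A *ᴹ B a) i j)
        ≈⟨ sumᴹ-∑ (λ a → A *ᴹ B a) i j ⟨
      sumᴹ (λ a → A *ᴹ B a) i j ∎

    sumᴹ-*ᴹ : ∀ {m} (B : Fin m → Matrix n) A → sumᴹ B *ᴹ A ≈ᴹ sumᴹ (λ a → B a *ᴹ A)
    sumᴹ-*ᴹ B A i j = begin
      (sumᴹ B *ᴹ A) i j
        ≈⟨ *ᴹ-∑ (sumᴹ B) A i j ⟩
      ∑ (λ k → sumᴹ B i k * A k j)
        ≈⟨ ∑-cong (λ k → trans (*-comm _ _) (trans (*-congˡ (sumᴹ-∑ B i k)) (sym (∑-*ˡ _ _)))) ⟩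
      ∑ (λ k → ∑ (λ a → A k j * B a i k))
        ≈⟨ ∑-comm _ ⟩
      ∑ (λ a → ∑ (λ k → A k j * B a i k))
        ≈⟨ ∑-cong (λ a → trans (∑-cong λ k → *-comm _ _) (sym (*ᴹ-∑ (B a) A i j))) ⟩
      ∑ (λ a → (B a *ᴹ A) i j)
        ≈⟨ sumᴹ-∑ (λ a → B a *ᴹ A) i j ⟨
      sumᴹ (λ a → B a *ᴹ A) i j ∎

    sumᴹ-cong : ∀ {m} {A B : Fin m → Matrix n} → (∀ a → A a ≈ᴹ B a) → sumᴹ A ≈ᴹ sumᴹ B
    sumᴹ-cong {A = A} {B} e i j =
      trans (sumᴹ-∑ A i j) (trans (∑-cong λ a → e a i j) (sym (sumᴹ-∑ B i j)))

    ^ᴹ-commute : ∀ (A : Matrix n) m → A ^ᴹ m *ᴹ A ≈ᴹ A *ᴹ A ^ᴹ m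
    ^ᴹ-commute A zero    i j = trans (*ᴹ-identityˡ A i j) (sym (*ᴹ-identityʳ A i j))
    ^ᴹ-commute A (suc m) i j = trans (*ᴹ-assoc A (A ^ᴹ m) A i j) (*ᴹ-congˡ A (^ᴹ-commute A m) i j)

    inverse-unique : ∀ {A B C : Matrix n} → B *ᴹ A ≈ᴹ I → A *ᴹ C ≈ᴹ I → B ≈ᴹ C
    inverse-unique {A} {B} {C} BA AC i j = begin
      B i j                 ≈⟨ *ᴹ-identityʳ B i j ⟨
      (B *ᴹ I) i j          ≈⟨ *ᴹ-congˡ B AC i j ⟨
      (B *ᴹ (A *ᴹ C)) i j   ≈⟨ *ᴹ-assoc B A C i j ⟨
      ((B *ᴹ A) *ᴹ C) i j   ≈⟨ *ᴹ-congʳ C BA i j ⟩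
      (I *ᴹ C) i j          ≈⟨ *ᴹ-identityˡ C i j ⟩
      C i j                 ∎

-- The resolvent as a polynomial in the Kirchhoff matrix

module Resolvent {c ℓ₁ ℓ₂ ℓ₃} (K : OrderedField c ℓ₁ ℓ₂ ℓ₃) {n}
  (Γ : WeightedDigraphs.WeightedDigraph K n) (τ : OrderedField.Carrier K) where

  open OrderedField K
  open Matrices K
  open WeightedDigraphs K
  open WeightedDigraph Γ
  open MatrixProperties K
  open ForestWeights K Γ
  open MonoidSum +-monoid using (sum; sum-init-last; sum-cong-≗)
  open Exp semiring using (_^_)
  open GroupProperties (CommutativeRing.+-group commutativeRing) using (inverseˡ-unique; ∙-cancelʳ)
  open Summation (CommutativeRing.commutativeSemiring commutativeRing)
  open SemiringSolver (CommutativeRing.commutativeSemiring commutativeRing) using (solve; _:+_; _:*_; _:=_)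
  open import Relation.Binary.Reasoning.Setoid (CommutativeRing.setoid commutativeRing)

  -- Off the diagonal the two terms cancel. On it, looplessness gives `ε i i ≈ 0#`, so the sum over
  -- the vertices other than `i` is the full sum.
  L-entry : ∀ i p → L Γ i p + ε p i ≈ I i p * ∑ (λ k → ε k i)
  L-entry i p with i ≟ p
  ... | no _       = trans (-‿inverseˡ _) (sym (zeroˡ _))
  ... | yes ≡.refl = begin
    - sum (λ k → L-off Γ i k) + ε i i ≈⟨ +-congˡ (¬arc⇒zero (loopless i)) ⟩
    - sum (λ k → L-off Γ i k) + 0#    ≈⟨ +-identityʳ _ ⟩
    - sum (λ k → L-off Γ i k)         ≡⟨ cong -_ (∑≡sum (λ k → L-off Γ i k)) ⟨
    - ∑ (λ k → L-off Γ i k)           ≈⟨ column-sum ⟨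
    ∑ (λ k → ε k i)                   ≈⟨ *-identityˡ _ ⟨
    1# * ∑ (λ k → ε k i)              ∎
    where
    cancel : ∀ k → ε k i + L-off Γ i k ≈ 0#
    cancel k with i ≟ k
    ... | yes ≡.refl = trans (+-identityʳ _) (¬arc⇒zero (loopless i))
    ... | no _       = -‿inverseʳ _

    column-sum : ∑ (λ k → ε k i) ≈ - ∑ (λ k → L-off Γ i k)
    column-sum = inverseˡ-unique _ _ (trans (sym (∑-+ _ _)) (∑-zero cancel))

  L-*ᴹ : ∀ X i j → (L Γ *ᴹ X) i j + ∑ (λ p → ε p i * X p j) ≈ ∑ (λ p → ε p i * X i j)
  L-*ᴹ X i j = begin
    (L Γ *ᴹ X) i j + ∑ (λ p → ε p i * X p j)
      ≈⟨ +-congʳ (*ᴹ-∑ (L Γ) X i j) ⟩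
    ∑ (λ p → L Γ i p * X p j) + ∑ (λ p → ε p i * X p j)
      ≈⟨ ∑-+ _ _ ⟨
    ∑ (λ p → L Γ i p * X p j + ε p i * X p j)
      ≈⟨ ∑-cong (λ p → trans (sym (distribʳ _ _ _)) (trans (*-congʳ (L-entry i p)) (*-assoc _ _ _))) ⟩
    ∑ (λ p → I i p * (∑ (λ k → ε k i) * X p j))
      ≈⟨ ∑-Iˡ i (λ p → ∑ (λ k → ε k i) * X p j) ⟩
    ∑ (λ k → ε k i) * X i j
      ≈⟨ trans (*-comm _ _) (sym (∑-*ˡ _ _)) ⟩
    ∑ (λ p → X i j * ε p i)
      ≈⟨ ∑-cong (λ p → *-comm _ _) ⟩
    ∑ (λ p → ε p i * X i j) ∎

  rootedSum-recurrence : ∀ k i j →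
    rootedSum (suc k) i j + (L Γ *ᴹ rootedSum k) i j ≈ I i j * σ Γ (suc k)
  rootedSum-recurrence k i j = ∙-cancelʳ S _ _ (begin
    Q′ + LQ + S
      ≈⟨ +-assoc _ _ _ ⟩
    Q′ + (LQ + S)
      ≈⟨ +-congˡ (L-*ᴹ (rootedSum k) i j) ⟩
    Q′ + ∑ (λ p → ε p i * rootedSum k i j)
      ≈⟨ rootedSum-suc k i j ⟩
    I i j * forestSum (suc k) + S
      ≈⟨ +-congʳ (*-congˡ (σ≈forestSum (suc k))) ⟨
    I i j * σ Γ (suc k) + S ∎)
    where
    Q′ = rootedSum (suc k) i j
    LQ = (L Γ *ᴹ rootedSum k) i j
    S  = ∑ (λ p → ε p i * rootedSum k p j)

  N : Matrix n
  N = (- τ) · L Γ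

  -- With the factor `τ ^ k` the recurrence becomes that of `S-suc`, with `τ ^ k * σ Γ k` in place
  -- of `s Γ k τ`.
  R : ℕ → Matrix n
  R k = (τ ^ k) · rootedSum k

  R-zero : ∀ i j → R 0 i j ≈ τ ^ 0 * σ Γ 0 * I i j
  R-zero i j = begin
    τ ^ 0 * rootedSum 0 i j       ≈⟨ *-congˡ (rootedSum-zero i j) ⟩
    τ ^ 0 * (I i j * forestSum 0) ≈⟨ *-congˡ (trans (*-comm _ _) (*-congʳ (sym (σ≈forestSum 0)))) ⟩
    τ ^ 0 * (σ Γ 0 * I i j)       ≈⟨ *-assoc _ _ _ ⟨
    τ ^ 0 * σ Γ 0 * I i j         ∎

  R-suc : ∀ k i j → R (suc k) i j ≈ τ ^ suc k * σ Γ (suc k) * I i j + (N *ᴹ R k) i j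
  R-suc k i j = begin
    τ ^ suc k * Q′
      ≈⟨ +-identityʳ _ ⟨
    τ ^ suc k * Q′ + 0#
      ≈⟨ +-congˡ cancel ⟨
    τ ^ suc k * Q′ + (τ ^ suc k * LQ + (N *ᴹ R k) i j)
      ≈⟨ solve 4 (λ t q l x → t :* q :+ (t :* l :+ x) := t :* (q :+ l) :+ x) refl (τ ^ suc k) Q′ LQ _ ⟩
    τ ^ suc k * (Q′ + LQ) + (N *ᴹ R k) i j
      ≈⟨ +-congʳ (*-congˡ (trans (rootedSum-recurrence k i j) (*-comm _ _))) ⟩
    τ ^ suc k * (σ Γ (suc k) * I i j) + (N *ᴹ R k) i j
      ≈⟨ +-congʳ (*-assoc _ _ _) ⟨
    τ ^ suc k * σ Γ (suc k) * I i j + (N *ᴹ R k) i j ∎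
    where
    Q′ = rootedSum (suc k) i j
    LQ = (L Γ *ᴹ rootedSum k) i j

    cancel : τ ^ suc k * LQ + (N *ᴹ R k) i j ≈ 0#
    cancel = begin
      τ ^ suc k * LQ + (N *ᴹ R k) i j
        ≈⟨ +-congˡ (trans (*ᴹ-scaleˡ (- τ) (L Γ) (R k) i j)
                          (*-congˡ (*ᴹ-scaleʳ (τ ^ k) (L Γ) (rootedSum k) i j))) ⟩
      τ * τ ^ k * LQ + (- τ) * (τ ^ k * LQ)
        ≈⟨ solve 4 (λ t u p l → t :* p :* l :+ u :* (p :* l) := (t :+ u) :* (p :* l)) refl τ (- τ) (τ ^ k) LQ ⟩
      (τ + - τ) * (τ ^ k * LQ)
        ≈⟨ trans (*-congʳ (-‿inverseʳ τ)) (zeroˡ _) ⟩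
      0# ∎

  S : ℕ → Matrix n
  S k = sumᴹ {m = suc k} (λ i → s Γ (k ∸ toℕ i) τ · N ^ᴹ toℕ i)

  s-suc : ∀ k → s Γ (suc k) τ ≈ s Γ k τ + τ ^ suc k * σ Γ (suc k)
  s-suc k = trans (sum-init-last (term ∘ toℕ)) (reflexive (cong₂ _+_
    (sum-cong-≗ λ (j : Fin (suc k)) → cong term (Fin.toℕ-inject₁ j)) (cong term (Fin.toℕ-fromℕ (suc k)))))
    where
    term : ℕ → Carrier
    term j = τ ^ j * σ Γ j

  S-suc : ∀ k i j → S (suc k) i j ≈ s Γ (suc k) τ * I i j + (N *ᴹ S k) i j
  -- The summand of index 0 splits off by computation. In the others `suc k ∸ suc a` computes to
  -- `k ∸ a`, so extracting one factor `N` leaves `S k`, as in Horner's scheme.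
  S-suc k i j = +-congˡ (trans
    (sumᴹ-cong {A = λ (a : Fin (suc k)) → s Γ (k ∸ toℕ a) τ · (N *ᴹ N ^ᴹ toℕ a)}
      (λ a p q → sym (*ᴹ-scaleʳ (s Γ (k ∸ toℕ a) τ) N (N ^ᴹ toℕ a) p q)) i j)
    (sym (*ᴹ-sumᴹ N (λ (a : Fin (suc k)) → s Γ (k ∸ toℕ a) τ · N ^ᴹ toℕ a) i j)))

  -- `S k` is a polynomial in `N`. This makes the inverse two-sided without determinants.
  S-commute : ∀ k → S k *ᴹ N ≈ᴹ N *ᴹ S k
  S-commute k i j = begin
    (S k *ᴹ N) i j                  ≈⟨ sumᴹ-*ᴹ summand N i j ⟩
    sumᴹ (λ a → summand a *ᴹ N) i j ≈⟨ sumᴹ-cong commute i j ⟩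
    sumᴹ (λ a → N *ᴹ summand a) i j ≈⟨ *ᴹ-sumᴹ N summand i j ⟨
    (N *ᴹ S k) i j                  ∎
    where
    summand : Fin (suc k) → Matrix n
    summand a = s Γ (k ∸ toℕ a) τ · N ^ᴹ toℕ a

    commute : ∀ a → summand a *ᴹ N ≈ᴹ N *ᴹ summand a
    commute a p q = trans (*ᴹ-scaleˡ (s Γ (k ∸ toℕ a) τ) (N ^ᴹ toℕ a) N p q)
      (trans (*-congˡ (^ᴹ-commute N (toℕ a) p q)) (sym (*ᴹ-scaleʳ (s Γ (k ∸ toℕ a) τ) N (N ^ᴹ toℕ a) p q)))

  S-zero : ∀ i j → S 0 i j ≈ R 0 i j
  S-zero i j = begin
    s Γ 0 τ * I i j + 0#    ≈⟨ +-identityʳ _ ⟩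
    s Γ 0 τ * I i j         ≈⟨ *-congʳ (+-identityʳ _) ⟩
    τ ^ 0 * σ Γ 0 * I i j   ≈⟨ R-zero i j ⟨
    R 0 i j                 ∎

  -- Consecutive values of `s` differ by `τ ^ suc k * σ Γ (suc k)`, so the differences of `S` obey
  -- the recurrence of `R`; induction compares the two.
  S-increment : ∀ k → S (suc k) ≈ᴹ S k +ᴹ R (suc k)
  S-increment zero    i j = begin
    S 1 i j
      ≈⟨ S-suc 0 i j ⟩
    s Γ 1 τ * I i j + (N *ᴹ S 0) i j
      ≈⟨ +-cong (*-congʳ (s-suc 0)) (*ᴹ-congˡ N S-zero i j) ⟩
    (s Γ 0 τ + t) * I i j + (N *ᴹ R 0) i j
      ≈⟨ solve 4 (λ s t x y → (s :+ t) :* x :+ y := s :* x :+ (t :* x :+ y)) refl (s Γ 0 τ) t (I i j) _ ⟩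
    s Γ 0 τ * I i j + (t * I i j + (N *ᴹ R 0) i j)
      ≈⟨ +-cong (sym (+-identityʳ _)) (sym (R-suc 0 i j)) ⟩
    S 0 i j + R 1 i j ∎
    where t = τ ^ 1 * σ Γ 1
  S-increment (suc k) i j = begin
    S (suc (suc k)) i j
      ≈⟨ S-suc (suc k) i j ⟩
    s Γ (suc (suc k)) τ * I i j + (N *ᴹ S (suc k)) i j
      ≈⟨ +-cong (*-congʳ (s-suc (suc k)))
                (trans (*ᴹ-congˡ N (S-increment k) i j) (*ᴹ-distribˡ N (S k) (R (suc k)) i j)) ⟩
    (s Γ (suc k) τ + t) * I i j + ((N *ᴹ S k) i j + (N *ᴹ R (suc k)) i j)
      ≈⟨ solve 5 (λ s t x y z → (s :+ t) :* x :+ (y :+ z) := (s :* x :+ y) :+ (t :* x :+ z)) refl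
           (s Γ (suc k) τ) t (I i j) _ _ ⟩
    (s Γ (suc k) τ * I i j + (N *ᴹ S k) i j) + (t * I i j + (N *ᴹ R (suc k)) i j)
      ≈⟨ +-cong (S-suc k i j) (R-suc (suc k) i j) ⟨
    S (suc k) i j + R (suc (suc k)) i j ∎
    where t = τ ^ suc (suc k) * σ Γ (suc (suc k))

  I+τL : Matrix n
  I+τL = I +ᴹ τ · L Γ

  I+τL+N : I+τL +ᴹ N ≈ᴹ I
  I+τL+N i j = begin
    I i j + τ * L Γ i j + (- τ) * L Γ i j
      ≈⟨ solve 4 (λ x t u l → x :+ t :* l :+ u :* l := x :+ (t :+ u) :* l) refl (I i j) τ (- τ) (L Γ i j) ⟩
    I i j + (τ + - τ) * L Γ i j
      ≈⟨ +-congˡ (trans (*-congʳ (-‿inverseʳ τ)) (zeroˡ _)) ⟩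
    I i j + 0#
      ≈⟨ +-identityʳ _ ⟩
    I i j ∎

  module _ {v} (dim : IsOutForestDimension digraph v) where

    private m = n ∸ v

    -- Two things vanish at `suc m`: `R`, so that `S` is stationary, and `σ`, so that `s` is
    -- stationary too. The recursion for `S` thereby becomes an equation for `S m`.
    S-fixpoint : ∀ i j → S m i j ≈ s Γ m τ * I i j + (N *ᴹ S m) i j
    S-fixpoint i j = begin
      S m i j
        ≈⟨ +-identityʳ _ ⟨
      S m i j + 0#
        ≈⟨ +-congˡ (trans (*-congˡ (rootedSum-oversized dim i j)) (zeroʳ _)) ⟨
      S m i j + R (suc m) i j
        ≈⟨ S-increment m i j ⟨
      S (suc m) i j
        ≈⟨ S-suc m i j ⟩
      s Γ (suc m) τ * I i j + (N *ᴹ S m) i j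
        ≈⟨ +-congʳ (*-congʳ (trans (s-suc m) (trans (+-congˡ
             (trans (*-congˡ (trans (σ≈forestSum (suc m)) (forestSum-oversized dim))) (zeroʳ _))) (+-identityʳ _)))) ⟩
      s Γ m τ * I i j + (N *ᴹ S m) i j ∎

    [I+τL]*S : I+τL *ᴹ S m ≈ᴹ s Γ m τ · I
    [I+τL]*S i j = ∙-cancelʳ ((N *ᴹ S m) i j) _ _ (begin
      (I+τL *ᴹ S m) i j + (N *ᴹ S m) i j ≈⟨ *ᴹ-distribʳ I+τL N (S m) i j ⟨
      ((I+τL +ᴹ N) *ᴹ S m) i j           ≈⟨ *ᴹ-congʳ (S m) I+τL+N i j ⟩
      (I *ᴹ S m) i j                     ≈⟨ *ᴹ-identityˡ (S m) i j ⟩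
      S m i j                            ≈⟨ S-fixpoint i j ⟩
      s Γ m τ * I i j + (N *ᴹ S m) i j   ∎)

    S*[I+τL] : S m *ᴹ I+τL ≈ᴹ s Γ m τ · I
    S*[I+τL] i j = ∙-cancelʳ ((N *ᴹ S m) i j) _ _ (begin
      (S m *ᴹ I+τL) i j + (N *ᴹ S m) i j ≈⟨ +-congˡ (S-commute m i j) ⟨
      (S m *ᴹ I+τL) i j + (S m *ᴹ N) i j ≈⟨ *ᴹ-distribˡ (S m) I+τL N i j ⟨
      (S m *ᴹ (I+τL +ᴹ N)) i j           ≈⟨ *ᴹ-congˡ (S m) I+τL+N i j ⟩
      (S m *ᴹ I) i j                     ≈⟨ *ᴹ-identityʳ (S m) i j ⟩
      S m i j                            ≈⟨ S-fixpoint i j ⟩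
      s Γ m τ * I i j + (N *ᴹ S m) i j   ∎)

    inverse : (s#0 : s Γ m τ # 0#) → IsInverse I+τL (1/ s#0 · S m)
    inverse s#0 =
      (λ i j → trans (*ᴹ-scaleʳ (1/ s#0) I+τL (S m) i j) (trans (*-congˡ ([I+τL]*S i j)) (normalise i j))) ,
      (λ i j → trans (*ᴹ-scaleˡ (1/ s#0) (S m) I+τL i j) (trans (*-congˡ (S*[I+τL] i j)) (normalise i j)))
      where
      normalise : ∀ i j → 1/ s#0 * (s Γ m τ * I i j) ≈ I i j
      normalise i j = trans (sym (*-assoc _ _ _)) (trans (*-congʳ (1/-inverseˡ s#0)) (*-identityˡ _))

mainTheorem4 : ∀ {c ℓ₁ ℓ₂ ℓ₃} (K : OrderedField c ℓ₁ ℓ₂ ℓ₃) →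
    let open OrderedField K
        open Matrices K
        open WeightedDigraphs K
    in
    ∀ (n : ℕ) → n > 1 →
    ∀ (Γ : WeightedDigraph n) (v : ℕ) →
    IsOutForestDimension (WeightedDigraph.digraph Γ) v →
    ∀ (τ : Carrier) → 0# < τ →
    Σ[ s#0 ∈ s Γ (n ∸ v) τ # 0# ]
      (∃[ Q ] IsInverse (I +ᴹ τ · L Γ) Q) ×
      (∀ Q → IsInverse (I +ᴹ τ · L Γ) Q →
        Q ≈ᴹ 1/ s#0 · sumᴹ {m = suc (n ∸ v)}
          (λ i → s Γ (n ∸ v ∸ toℕ i) τ · ((- τ) · L Γ) ^ᴹ toℕ i))
mainTheorem4 K n _ Γ v dim τ 0<τ =
  -- Any inverse is a left inverse, hence equal to the right inverse just constructed.
  s#0 , (_ , inverse dim s#0) , λ Q (_ , Q*A) → inverse-unique {A = I+τL} Q*A (proj₁ (inverse dim s#0))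
  where
  open OrderedField K
  open WeightedDigraphs K
  open Resolvent K Γ τ
  open MatrixProperties K using (inverse-unique)
  s#0 : s Γ (n ∸ v) τ # 0#
  s#0 = Equivalence.from #⇔<⊎> (inj₂ (ForestWeights.s-pos K Γ (n ∸ v) 0<τ))
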